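{- Let $p_{1,3}(n)$ be defined by $\sum_{n\ge0}p_{1,3}(n)q^n=1/E_1^6$. Let $m(i,j)$ and $a(j,k)$ be the integer matrices defined below. Then for every positive integer $j$, \begin{align*} \sum_{n=0}^{\infty}p_{1,3}\left(3^{2j-1}n+\tfrac{3^{2j-1}+1}{4}\right)q^{n} &=\sum_{l=1}^{\infty}a(2j-1,l)q^{l-1}\frac{E_{3}^{12l-6}}{E_{1}^{12l}},\\ \sum_{n=0}^{\infty}p_{1,3}\left(3^{2j}n+\tfrac{3^{2j+1}+1}{4}\right)q^{n} &=\sum_{l=1}^{\infty}a(2j,l)q^{l-1}\frac{E_{3}^{12l}}{E_{1}^{12l+6}}. \end{align*}
   Context: $E_j=(q^j;q^j)_\infty=\prod_{n\ge1}(1-q^{jn})$. The matrix $\{m(i,j)\}_{i,j\ge1}$ is defined by (with $m(i,j)=0$ for $i\le0$): $m(1,1)=9$, $m(2,1)=6$, $m(3,1)=1$, $m(i,1)=0$ for $i\ge4$, and for $j\ge2$, $m(i,j)=27m(i-1,j-1)+9m(i-2,j-1)+m(i-3,j-1)$; one has $m(i,j)\ne0$ only if $\lfloor (i+2)/3\rfloor\le j\le i$. The matrix $\{a(j,k)\}_{j,k\ge1}$ is defined by $a(1,1)=6$, $a(1,2)=243$, $a(1,k)=0$ for $k\ge3$, and for $j,k\ge1$: $a(j+1,k)=\sum_{i\ge1}a(j,i)m(4i,i+k)$ if $j$ is odd, and $a(j+1,k)=\sum_{i\ge1}a(j,i)m(4i+2,i+k)$ if $j$ is even (these sums are finite). 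-}

module Defs where

open import Data.Nat as ℕ using (ℕ; zero; suc; _∸_; _<ᵇ_)
open import Data.Integer using (ℤ; +_; -_; _+_; _*_; 0ℤ; 1ℤ)
open import Data.List using (List; []; _∷_)
open import Data.Bool using (if_then_else_)

sum0 : ℕ → (ℕ → ℤ) → ℤ
sum0 zero    f = f 0
sum0 (suc n) f = sum0 n f + f (suc n)

sum1 : ℕ → (ℕ → ℤ) → ℤ
sum1 zero    f = 0ℤ
sum1 (suc n) f = sum1 n f + f (suc n)

-- Formal power series over ℤ, as coefficient sequences

PS : Set
PS = ℕ → ℤ

oneS : PS
oneS zero    = 1ℤ
oneS (suc _) = 0ℤ

_⊗_ : PS → PS → PS
(f ⊗ g) n = sum0 n (λ k → f k * g (n ∸ k))

infixl 7 _⊗_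

powS : PS → ℕ → PS
powS f zero    = oneS
powS f (suc e) = powS f e ⊗ f

shiftS : ℕ → PS → PS
shiftS zero    f         = f
shiftS (suc s) f zero    = 0ℤ
shiftS (suc s) f (suc n) = shiftS s f n

-- Multiplicative inverse of a series with constant term 1:
-- b 0 = 1, b n = - Σ_{k=1}^{n} f k * b (n - k).
-- invList f n = [b n , b (n-1) , … , b 0]
private
  conv : PS → List ℤ → ℕ → ℤ
  conv f []       k = 0ℤ
  conv f (b ∷ bs) k = f k * b + conv f bs (suc k)

invList : PS → ℕ → List ℤ
invList f zero    = 1ℤ ∷ []
invList f (suc n) = let bs = invList f n in (- conv f bs 1) ∷ bs

invS : PS → PS
invS f n with invList f n
... | []    = 0ℤ
... | b ∷ _ = b

-- E_j = ∏_{n≥1} (1 - q^{jn})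

oneMinusQ : ℕ → PS
oneMinusQ d n = (if n ℕ.≡ᵇ 0 then 1ℤ else 0ℤ) + (if n ℕ.≡ᵇ d then - 1ℤ else 0ℤ)

prodE : ℕ → ℕ → PS
prodE j zero    = oneS
prodE j (suc N) = prodE j N ⊗ oneMinusQ (j ℕ.* suc N)

-- For j ≥ 1 the coefficient of q^n in E_j only depends on factors with k ≤ n.
E : ℕ → PS
E j n = prodE j n n

p13 : ℕ → ℤ
p13 = invS (powS (E 1) 6)

-- The matrix m(i,j)  (m(i,j) = 0 for i ≤ 0; index j = 0 unused, set to 0)

m : ℕ → ℕ → ℤ
m zero          _               = 0ℤ
m (suc i)       zero            = 0ℤ
m 1             1               = + 9
m 2             1               = + 6
m 3             1               = + 1
m (suc i)       1               = 0ℤ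
m (suc i)       (suc (suc j))   =
  + 27 * m i (suc j) + + 9 * m (i ∸ 1) (suc j) + m (i ∸ 2) (suc j)

-- The matrix a(j,k)  (index 0 unused, set to 0)
-- The sums over i ≥ 1 are finite: m(4i, i+k) and m(4i+2, i+k) vanish
-- for i > 3k by the support property ⌊(r+2)/3⌋ ≤ c ≤ r of m(r,c).

odd? : ℕ → Data.Bool.Bool
odd? zero          = Data.Bool.false
odd? (suc zero)    = Data.Bool.true
odd? (suc (suc n)) = odd? n

a : ℕ → ℕ → ℤ
a zero          _ = 0ℤ
a 1             1 = + 6
a 1             2 = + 243
a 1             _ = 0ℤ
a (suc (suc j)) k =
  sum1 (3 ℕ.* k) (λ i → a (suc j) i *
     m (if odd? (suc j) then 4 ℕ.* i else 4 ℕ.* i ℕ.+ 2) (i ℕ.+ k))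

-- Right-hand sides, as power series:
-- Σ_{l≥1} a(r,l) q^{l-1} E_3^{12l-6} / E_1^{12l}   and
-- Σ_{l≥1} a(r,l) q^{l-1} E_3^{12l}   / E_1^{12l+6}.
-- Only l ≤ n+1 contributes to the coefficient of q^n.

rhsOdd : ℕ → PS
rhsOdd r n = sum1 (suc n) (λ l →
  a r l * shiftS (l ∸ 1)
    (powS (E 3) (12 ℕ.* l ∸ 6) ⊗ invS (powS (E 1) (12 ℕ.* l))) n)

rhsEven : ℕ → PS
rhsEven r n = sum1 (suc n) (λ l →
  a r l * shiftS (l ∸ 1)
    (powS (E 3) (12 ℕ.* l) ⊗ invS (powS (E 1) (12 ℕ.* l ℕ.+ 6))) n)

{-# OPTIONS --safe #-}
module Submission where

-- Jacobi's identity E₁³ = Σ (-1)^k (2k+1) q^(k(k+1)/2) is the limit of a finite identity: the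
-- coefficients of ∏_{i=0}^{n} (1 - z q^i) ∏_{i=1}^{n} (1 - q^i/z) are antisymmetric, so weighting
-- them by 2k+1 (the derivative at z = 1) turns the passage from n to n+1 into multiplication by
-- (1 - q^(n+1))². Sorting the exponents k(k+1)/2 modulo 3 gives E₁³ = A - 3B with A a series in q³
-- and B = q E₉³; taking the norm to series in q³ gives A³ - 27B³ = E₃¹²/E₉³. Hence x = B/E₁³
-- satisfies x³ = (1 + 9x + 27x²) t(q³) with t = q E₃¹²/E₁¹², and extracting the exponents
-- divisible by 3 from x^i yields Σ_j m(i,j) t^j. Finally t^l t(q³)^l = x^(4l), so the dissection
-- of each t^l is read off row 4l of m (or row 4l+2, after multiplying by q²), which is the
-- recurrence defining a.

open import Defs
open import Algebra.Bundles using (CommutativeRing)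
import Algebra.Properties.CommutativeSemigroup as CommutativeSemigroupProperties
import Algebra.Solver.Ring as RingSolver
open import Algebra.Solver.Ring.AlmostCommutativeRing
  using (fromCommutativeRing; _-Raw-AlmostCommutative⟶_)
open import Algebra.Structures using (IsCommutativeRing)
open import Data.Bool using (true; false; if_then_else_)
open import Data.Integer as ℤ using (ℤ; +_; 0ℤ; 1ℤ)
import Data.Integer.Properties as ℤₚ
open import Data.Integer.Solver using (module +-*-Solver)
open import Data.List using (List; []; _∷_)
open import Data.Maybe using (Maybe; map)
open import Data.Nat as ℕ using (zero; suc; z≤n; s≤s; _<_)
open import Data.Nat using (ℕ; _+_; _*_; _∸_; _^_; _/_; _≤_)
import Data.Nat.DivMod as ℕ÷
import Data.Nat.Properties as ℕₚ
open import Data.Nat.Tactic.RingSolver using (solve-∀)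
open import Data.Product using (_×_; _,_)
open import Data.Sum using (inj₁; inj₂)
open import Level using (0ℓ)
open import Relation.Binary.PropositionalEquality
  using (_≡_; refl; sym; trans; cong; cong₂; subst; module ≡-Reasoning)
import Relation.Binary.Reasoning.Setoid as SetoidReasoning
open import Relation.Binary.Structures using (IsEquivalence)
open import Relation.Nullary.Decidable using (dec⇒maybe)

-- The ring of formal power series

-- The norm makes it possible to work with A without identifying it. For a primitive cube root of
-- unity ω the conjugates of E₁³ = A - 3B are A - 3ω^i B, so A³ - 27B³ is their product and hence
-- the cube of the norm of E₁. That norm can be read off the product: a factor 1 - q^k with k prime
-- to 3 has norm 1 - q^(3k), and a factor in q³ is cubed. The cubic for x is then 1/x = A/B - 3
-- solved for A/B: (1/x + 3)³ - 27 = 1/t(q³), which is where the coefficients 9 and 27 in the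
-- recurrence of m come from. Neither roots of unity nor limits appear formally. The norm is a cubic
-- form in the three residue parts, and infinite products and sums are compared modulo q^(N+1) for
-- every N. The series of the theorem are carried with one extra factor q, so that q^(l-1) becomes
-- q^l and each summand a power of t times a fixed series. The residue classes to be extracted, 2
-- and 0 modulo 3, thereby become 0 and 1.

infix 4 _≋_
record _≋_ (f g : PS) : Set where
  constructor pointwise
  field at : ∀ n → f n ≡ g n
open _≋_ public

≋-isEquivalence : IsEquivalence _≋_
≋-isEquivalence = record
  { refl  = pointwise λ _ → refl
  ; sym   = λ p → pointwise λ n → sym (at p n)
  ; trans = λ p r → pointwise λ n → trans (at p n) (at r n)
  }

private
  module ≋ = IsEquivalence ≋-isEquivalence

tail : PS → PS
tail f n = f (suc n)

sum0-cong≤ : ∀ n {f g} → (∀ k → k ≤ n → f k ≡ g k) → sum0 n f ≡ sum0 n g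
sum0-cong≤ zero    h = h 0 z≤n
sum0-cong≤ (suc n) h =
  cong₂ ℤ._+_ (sum0-cong≤ n λ k k≤n → h k (ℕₚ.m≤n⇒m≤1+n k≤n)) (h (suc n) ℕₚ.≤-refl)

sum0-suc : ∀ n f → sum0 (suc n) f ≡ f 0 ℤ.+ sum0 n (λ k → f (suc k))
sum0-suc zero    f = refl
sum0-suc (suc n) f = trans (cong (ℤ._+ f (suc (suc n))) (sum0-suc n f)) (ℤₚ.+-assoc (f 0) _ _)

-- Opaque, because unfolding to coefficients would prevent the arguments of _≋_ from being inferred.
opaque
  infixl 6 _⊕_
  _⊕_ : PS → PS → PS
  (f ⊕ g) n = f n ℤ.+ g n

  infixl 7 _·_
  _·_ : PS → PS → PS
  _·_ = _⊗_

  ·≋⊗ : ∀ f g → f · g ≋ f ⊗ g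
  ·≋⊗ f g = pointwise λ _ → refl

  ⊕-at : ∀ f g n → (f ⊕ g) n ≡ f n ℤ.+ g n
  ⊕-at f g n = refl

  infix 8 ⊝_
  ⊝_ : PS → PS
  (⊝ f) n = ℤ.- f n

  ι : ℤ → PS
  ι c zero    = c
  ι c (suc n) = 0ℤ

  q : PS
  q = shiftS 1 oneS

  -- Splitting off the first coefficient of the left factor lets the laws of the product be proved
  -- by induction on the index, with `tail f` in place of `f`, instead of by re-indexing double
  -- sums.
  ·-suc : ∀ f g n → (f · g) (suc n) ≡ f 0 ℤ.* g (suc n) ℤ.+ (tail f · g) n
  ·-suc f g n = sum0-suc n _

  ·-sucʳ : ∀ f g n → (f · g) (suc n) ≡ (f · tail g) n ℤ.+ f (suc n) ℤ.* g 0
  ·-sucʳ f g n = cong₂ ℤ._+_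
    (sum0-cong≤ n λ k k≤n → cong (λ i → f k ℤ.* g i) (ℕₚ.+-∸-assoc 1 k≤n))
    (cong (λ i → f (suc n) ℤ.* g i) (ℕₚ.n∸n≡0 n))

  ·-cong≤ : ∀ n {f f′ g g′} → (∀ k → k ≤ n → f k ≡ f′ k) → (∀ k → k ≤ n → g k ≡ g′ k) →
            (f · g) n ≡ (f′ · g′) n
  ·-cong≤ n p r = sum0-cong≤ n λ k k≤n → cong₂ ℤ._*_ (p k k≤n) (r (n ∸ k) (ℕₚ.m∸n≤m n k))

  ·-cong : ∀ {f f′ g g′} → f ≋ f′ → g ≋ g′ → f · g ≋ f′ · g′
  ·-cong p r = pointwise λ n → ·-cong≤ n (λ k _ → at p k) (λ k _ → at r k)

  ·-comm : ∀ f g → f · g ≋ g · f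
  ·-comm f g = pointwise (go f g)
    where
    go : ∀ f g n → (f · g) n ≡ (g · f) n
    go f g zero    = ℤₚ.*-comm (f 0) (g 0)
    go f g (suc n) = begin
      (f · g) (suc n)                            ≡⟨ ·-suc f g n ⟩
      f 0 ℤ.* g (suc n) ℤ.+ (tail f · g) n       ≡⟨ cong₂ ℤ._+_ (ℤₚ.*-comm (f 0) _) (go (tail f) g n) ⟩
      g (suc n) ℤ.* f 0 ℤ.+ (g · tail f) n       ≡⟨ ℤₚ.+-comm (g (suc n) ℤ.* f 0) _ ⟩
      (g · tail f) n ℤ.+ g (suc n) ℤ.* f 0       ≡⟨ ·-sucʳ g f n ⟨
      (g · f) (suc n)                            ∎
      where open ≡-Reasoning

  ·-distribʳ : ∀ h f g → (f ⊕ g) · h ≋ f · h ⊕ g · h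
  ·-distribʳ h f g = pointwise (go f g)
    where
    go : ∀ f g n → ((f ⊕ g) · h) n ≡ (f · h) n ℤ.+ (g · h) n
    go f g zero    = ℤₚ.*-distribʳ-+ (h 0) (f 0) (g 0)
    go f g (suc n) = begin
      ((f ⊕ g) · h) (suc n)
        ≡⟨ ·-suc (f ⊕ g) h n ⟩
      (f 0 ℤ.+ g 0) ℤ.* h (suc n) ℤ.+ ((tail f ⊕ tail g) · h) n
        ≡⟨ cong (λ z → (f 0 ℤ.+ g 0) ℤ.* h (suc n) ℤ.+ z) (go (tail f) (tail g) n) ⟩
      (f 0 ℤ.+ g 0) ℤ.* h (suc n) ℤ.+ ((tail f · h) n ℤ.+ (tail g · h) n)
        ≡⟨ solve 5 (λ a b c x y → (a :+ b) :* c :+ (x :+ y) := (a :* c :+ x) :+ (b :* c :+ y))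
             refl (f 0) (g 0) (h (suc n)) _ _ ⟩
      (f 0 ℤ.* h (suc n) ℤ.+ (tail f · h) n) ℤ.+ (g 0 ℤ.* h (suc n) ℤ.+ (tail g · h) n)
        ≡⟨ cong₂ ℤ._+_ (·-suc f h n) (·-suc g h n) ⟨
      (f · h) (suc n) ℤ.+ (g · h) (suc n) ∎
      where
      open ≡-Reasoning
      open +-*-Solver

  scale-· : ∀ c f g n → ((λ k → c ℤ.* f k) · g) n ≡ c ℤ.* (f · g) n
  scale-· c f g zero    = ℤₚ.*-assoc c (f 0) (g 0)
  scale-· c f g (suc n) = begin
    ((λ k → c ℤ.* f k) · g) (suc n)
      ≡⟨ ·-suc (λ k → c ℤ.* f k) g n ⟩
    c ℤ.* f 0 ℤ.* g (suc n) ℤ.+ ((λ k → c ℤ.* f (suc k)) · g) n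
      ≡⟨ cong₂ ℤ._+_ (ℤₚ.*-assoc c (f 0) _) (scale-· c (tail f) g n) ⟩
    c ℤ.* (f 0 ℤ.* g (suc n)) ℤ.+ c ℤ.* (tail f · g) n
      ≡⟨ ℤₚ.*-distribˡ-+ c (f 0 ℤ.* g (suc n)) _ ⟨
    c ℤ.* (f 0 ℤ.* g (suc n) ℤ.+ (tail f · g) n)
      ≡⟨ cong (λ z → c ℤ.* z) (·-suc f g n) ⟨
    c ℤ.* (f · g) (suc n) ∎
    where open ≡-Reasoning

  ·-assoc : ∀ f g h → (f · g) · h ≋ f · (g · h)
  ·-assoc f g h = pointwise (go f)
    where
    go : ∀ f n → ((f · g) · h) n ≡ (f · (g · h)) n
    go f zero    = ℤₚ.*-assoc (f 0) (g 0) (h 0)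
    go f (suc n) = begin
      ((f · g) · h) (suc n)
        ≡⟨ ·-suc (f · g) h n ⟩
      f 0 ℤ.* g 0 ℤ.* h (suc n) ℤ.+ (tail (f · g) · h) n
        ≡⟨ cong (λ z → c ℤ.+ z) (·-cong≤ n {tail (f · g)} {f₀g ⊕ tail f · g} {h}
             (λ k _ → ·-suc f g k) (λ _ _ → refl)) ⟩
      c ℤ.+ ((f₀g ⊕ tail f · g) · h) n
        ≡⟨ cong (λ z → c ℤ.+ z) (at (·-distribʳ h f₀g (tail f · g)) n) ⟩
      c ℤ.+ ((f₀g · h) n ℤ.+ ((tail f · g) · h) n)
        ≡⟨ cong₂ (λ x y → c ℤ.+ (x ℤ.+ y)) (scale-· (f 0) (tail g) h n) (go (tail f) n) ⟩
      c ℤ.+ (f 0 ℤ.* (tail g · h) n ℤ.+ (tail f · (g · h)) n)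
        ≡⟨ solve 5 (λ a b c x y → a :* b :* c :+ (a :* x :+ y) := a :* (b :* c :+ x) :+ y)
             refl (f 0) (g 0) (h (suc n)) _ _ ⟩
      f 0 ℤ.* (g 0 ℤ.* h (suc n) ℤ.+ (tail g · h) n) ℤ.+ (tail f · (g · h)) n
        ≡⟨ cong (λ x → f 0 ℤ.* x ℤ.+ (tail f · (g · h)) n) (·-suc g h n) ⟨
      f 0 ℤ.* (g · h) (suc n) ℤ.+ (tail f · (g · h)) n
        ≡⟨ ·-suc f (g · h) n ⟨
      (f · (g · h)) (suc n) ∎
      where
      open ≡-Reasoning
      open +-*-Solver
      c : ℤ
      c = f 0 ℤ.* g 0 ℤ.* h (suc n)
      f₀g : PS
      f₀g k = f 0 ℤ.* g (suc k)

  0· : ∀ f {z} → (∀ n → z n ≡ 0ℤ) → ∀ n → (z · f) n ≡ 0ℤ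
  0· f h zero    = cong (ℤ._* f 0) (h 0)
  0· f {z} h (suc n) = trans (·-suc z f n)
    (cong₂ ℤ._+_ (cong (ℤ._* f (suc n)) (h 0)) (0· f (λ k → h (suc k)) n))

  ι· : ∀ c f n → (ι c · f) n ≡ c ℤ.* f n
  ι· c f zero    = refl
  ι· c f (suc n) = trans (·-suc (ι c) f n)
    (trans (cong (λ z → c ℤ.* f (suc n) ℤ.+ z) (0· f (λ _ → refl) n)) (ℤₚ.+-identityʳ _))

  q· : ∀ f n → (q · f) (suc n) ≡ f n
  q· f n = trans (·-suc q f n) (trans (ℤₚ.+-identityˡ _)
    (trans (·-cong≤ n {tail q} {ι 1ℤ} {f} (λ { zero _ → refl ; (suc _) _ → refl }) (λ _ _ → refl))
      (trans (ι· 1ℤ f n) (ℤₚ.*-identityˡ (f n)))))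

  ·-identityˡ : ∀ f → ι 1ℤ · f ≋ f
  ·-identityˡ f = pointwise λ n → trans (ι· 1ℤ f n) (ℤₚ.*-identityˡ (f n))

  ι0 : ∀ n → ι 0ℤ n ≡ 0ℤ
  ι0 zero    = refl
  ι0 (suc n) = refl

  ⊕-·-isCommutativeRing : IsCommutativeRing _≋_ _⊕_ _·_ ⊝_ (ι 0ℤ) (ι 1ℤ)
  ⊕-·-isCommutativeRing = record
    { isRing = record
      { +-isAbelianGroup = record
        { isGroup = record
          { isMonoid = record
            { isSemigroup = record
              { isMagma = record
                { isEquivalence = ≋-isEquivalence
                ; ∙-cong = λ p r → pointwise λ n → cong₂ ℤ._+_ (at p n) (at r n)
                }
              ; assoc = λ f g h → pointwise λ n → ℤₚ.+-assoc (f n) (g n) (h n)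
              }
            ; identity =
                (λ f → pointwise λ n → trans (cong (ℤ._+ f n) (ι0 n)) (ℤₚ.+-identityˡ (f n)))
              , (λ f → pointwise λ n → trans (cong (λ z → f n ℤ.+ z) (ι0 n)) (ℤₚ.+-identityʳ (f n)))
            }
          ; inverse =
              (λ f → pointwise λ n → trans (ℤₚ.+-inverseˡ (f n)) (sym (ι0 n)))
            , (λ f → pointwise λ n → trans (ℤₚ.+-inverseʳ (f n)) (sym (ι0 n)))
          ; ⁻¹-cong = λ p → pointwise λ n → cong ℤ.-_ (at p n)
          }
        ; comm = λ f g → pointwise λ n → ℤₚ.+-comm (f n) (g n)
        }
      ; *-cong = ·-cong
      ; *-assoc = ·-assoc
      ; *-identity = ·-identityˡ , λ f → ≋.trans (·-comm f (ι 1ℤ)) (·-identityˡ f)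
      ; distrib =
          (λ f g h → ≋.trans (·-comm f (g ⊕ h)) (≋.trans (·-distribʳ f g h)
            (pointwise λ n → cong₂ ℤ._+_ (at (·-comm g f) n) (at (·-comm h f) n))))
        , ·-distribʳ
      }
    ; *-comm = ·-comm
    }

  ι-zero : ∀ c → ι c 0 ≡ c
  ι-zero c = refl

  ι-suc : ∀ c n → ι c (suc n) ≡ 0ℤ
  ι-suc c n = refl

  ·-zero : ∀ f g → (f · g) 0 ≡ f 0 ℤ.* g 0
  ·-zero f g = refl

  ⊝-at : ∀ f n → (⊝ f) n ≡ ℤ.- f n
  ⊝-at f n = refl

  q-zero : ∀ f → (q · f) 0 ≡ 0ℤ
  q-zero f = refl

  ι-+ : ∀ a b → ι (a ℤ.+ b) ≋ ι a ⊕ ι b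
  ι-+ a b = pointwise λ { zero → refl ; (suc n) → refl }

  ι-* : ∀ a b → ι (a ℤ.* b) ≋ ι a · ι b
  ι-* a b = pointwise λ { zero → refl
                        ; (suc n) → sym (trans (ι· a (ι b) (suc n)) (ℤₚ.*-zeroʳ a)) }

  ι-neg : ∀ a → ι (ℤ.- a) ≋ ⊝ ι a
  ι-neg a = pointwise λ { zero → refl ; (suc n) → refl }

PSRing : CommutativeRing 0ℓ 0ℓ
PSRing = record { isCommutativeRing = ⊕-·-isCommutativeRing }

-- Lets the ring solver evaluate integer constants such as 27 and 243 in ℤ.
ι-morphism : ℤ.+-*-rawRing -Raw-AlmostCommutative⟶ fromCommutativeRing PSRing
ι-morphism = record
  { ⟦_⟧    = ι
  ; +-homo = ι-+
  ; *-homo = ι-*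
  ; -‿homo = ι-neg
  ; 0-homo = ≋.refl
  ; 1-homo = ≋.refl
  }

ι-≟ : ∀ c d → Maybe (ι c ≋ ι d)
ι-≟ c d = map (λ c≡d → ≋.reflexive (cong ι c≡d)) (dec⇒maybe (c ℤₚ.≟ d))

module Solver = RingSolver ℤ.+-*-rawRing (fromCommutativeRing PSRing) ι-morphism ι-≟
open Solver using (solve; _:=_; _:+_; _:*_; _:-_; :-_; _:^_; con)

open CommutativeRing PSRing using (setoid)
  renaming ( +-cong to ⊕-cong; +-congˡ to ⊕-congˡ; +-congʳ to ⊕-congʳ; *-congˡ to ·-congˡ
           ; *-congʳ to ·-congʳ; -‿cong to ⊝-cong; *-identityʳ to ·-identityʳ
           ; refl to ≋-refl; sym to ≋-sym; trans to ≋-trans; reflexive to ≋-reflexive)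
open import Algebra.Properties.Semiring.Exp (CommutativeRing.semiring PSRing)
  using (^-congˡ; ^-homo-*; ^-assocʳ) renaming (_^_ to _↑_)
open import Algebra.Properties.CommutativeSemiring.Exp
  (CommutativeRing.commutativeSemiring PSRing) using (^-distrib-*)
module ≋-Reasoning = SetoidReasoning setoid

-- Defs keeps its convolution private, so the name is recovered by unification
-- with the unfolded right-hand side of invList.
convolve : PS → List ℤ → ℕ → ℤ
invList-suc : ∀ f n → invList f (suc n) ≡ (ℤ.- convolve f (invList f n) 1) ∷ invList f n

convolve = _
invList-suc f n with invList f n | 1
... | bs | k = refl

convolve-tail : ∀ f bs k → convolve f bs (suc k) ≡ convolve (tail f) bs k
convolve-tail f []       k = refl
convolve-tail f (b ∷ bs) k = cong (λ z → f (suc k) ℤ.* b ℤ.+ z) (convolve-tail f bs (suc k))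

-- `invList g n` lists the coefficients of `invS g` from index n down to 0, so pairing it with `f`
-- from index 0 upwards is the Cauchy product.
convolve-invList : ∀ f g n → convolve f (invList g n) 0 ≡ (f · invS g) n
convolve-invList f g zero    = trans (ℤₚ.+-identityʳ (f 0 ℤ.* 1ℤ)) (sym (·-zero f (invS g)))
convolve-invList f g (suc n) = begin
  f 0 ℤ.* invS g (suc n) ℤ.+ convolve f (invList g n) 1
    ≡⟨ cong (λ z → f 0 ℤ.* invS g (suc n) ℤ.+ z) (convolve-tail f (invList g n) 0) ⟩
  f 0 ℤ.* invS g (suc n) ℤ.+ convolve (tail f) (invList g n) 0
    ≡⟨ cong (λ z → f 0 ℤ.* invS g (suc n) ℤ.+ z) (convolve-invList (tail f) g n) ⟩
  f 0 ℤ.* invS g (suc n) ℤ.+ (tail f · invS g) n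
    ≡⟨ ·-suc f (invS g) n ⟨
  (f · invS g) (suc n) ∎
  where open ≡-Reasoning

·-inverseʳ : ∀ f → f 0 ≡ 1ℤ → f · invS f ≋ ι 1ℤ
·-inverseʳ f f0≡1 = pointwise go
  where
  go : ∀ n → (f · invS f) n ≡ ι 1ℤ n
  go zero    = trans (·-zero f (invS f)) (trans (cong (ℤ._* 1ℤ) f0≡1) (sym (ι-zero 1ℤ)))
  go (suc n) = begin
    (f · invS f) (suc n)
      ≡⟨ ·-suc f (invS f) n ⟩
    f 0 ℤ.* (ℤ.- convolve f (invList f n) 1) ℤ.+ (tail f · invS f) n
      ≡⟨ cong₂ (λ c z → c ℤ.* (ℤ.- z) ℤ.+ (tail f · invS f) n) f0≡1
           (trans (convolve-tail f (invList f n) 0) (convolve-invList (tail f) f n)) ⟩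
    1ℤ ℤ.* (ℤ.- (tail f · invS f) n) ℤ.+ (tail f · invS f) n
      ≡⟨ cong (ℤ._+ (tail f · invS f) n) (ℤₚ.*-identityˡ (ℤ.- (tail f · invS f) n)) ⟩
    (ℤ.- (tail f · invS f) n) ℤ.+ (tail f · invS f) n
      ≡⟨ ℤₚ.+-inverseˡ ((tail f · invS f) n) ⟩
    0ℤ
      ≡⟨ ι-suc 1ℤ n ⟨
    ι 1ℤ (suc n) ∎
    where open ≡-Reasoning

-- Stands in for division: an identity between quotients is checked after multiplication by a common
-- denominator.
inverse-unique : ∀ {f g h} → f · g ≋ ι 1ℤ → f · h ≋ ι 1ℤ → g ≋ h
inverse-unique {f} {g} {h} fg≋1 fh≋1 = begin
  g             ≈⟨ ·-identityʳ g ⟨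
  g · ι 1ℤ      ≈⟨ ·-congˡ {g} fh≋1 ⟨
  g · (f · h)   ≈⟨ solve 3 (λ f g h → g :* (f :* h) := f :* g :* h) ≋-refl f g h ⟩
  f · g · h     ≈⟨ ·-congʳ {h} fg≋1 ⟩
  ι 1ℤ · h      ≈⟨ ·-identityˡ h ⟩
  h             ∎
  where open ≋-Reasoning

oneS≋1 : oneS ≋ ι 1ℤ
oneS≋1 = pointwise λ { zero → sym (ι-zero 1ℤ) ; (suc n) → sym (ι-suc 1ℤ n) }

powS≋^ : ∀ f n → powS f n ≋ f ↑ n
powS≋^ f zero    = oneS≋1
powS≋^ f (suc n) = ≋-trans (≋-sym (·≋⊗ (powS f n) f))
  (≋-trans (·-congʳ {f} (powS≋^ f n)) (·-comm (f ↑ n) f))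

q·≋shift : ∀ n f → q · shiftS n f ≋ shiftS (suc n) f
q·≋shift n f = pointwise λ { zero → q-zero (shiftS n f) ; (suc k) → q· (shiftS n f) k }

shiftS≋ : ∀ n f → shiftS n f ≋ q ↑ n · f
shiftS≋ zero    f = ≋-sym (·-identityˡ f)
shiftS≋ (suc n) f = begin
  shiftS (suc n) f   ≈⟨ q·≋shift n f ⟨
  q · shiftS n f     ≈⟨ ·-congˡ {q} (shiftS≋ n f) ⟩
  q · (q ↑ n · f)    ≈⟨ ·-assoc q (q ↑ n) f ⟨
  q ↑ suc n · f      ∎
  where open ≋-Reasoning

q-cancel : ∀ {f g} → q · f ≋ q · g → f ≋ g
q-cancel {f} {g} p = pointwise λ n → trans (sym (q· f n)) (trans (at p (suc n)) (q· g n))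

-- Congruence modulo q^(N+1)

infix 4 _≋[_]_
record _≋[_]_ (f : PS) (N : ℕ) (g : PS) : Set where
  constructor upTo
  field at≤ : ∀ n → n ≤ N → f n ≡ g n
open _≋[_]_ public

module _ {N : ℕ} where
  []-refl : ∀ {f} → f ≋[ N ] f
  []-refl = upTo λ _ _ → refl

  ≋⇒≋[] : ∀ {f g} → f ≋ g → f ≋[ N ] g
  ≋⇒≋[] p = upTo λ n _ → at p n

  []-sym : ∀ {f g} → f ≋[ N ] g → g ≋[ N ] f
  []-sym p = upTo λ n n≤N → sym (at≤ p n n≤N)

  []-trans : ∀ {f g h} → f ≋[ N ] g → g ≋[ N ] h → f ≋[ N ] h
  []-trans p r = upTo λ n n≤N → trans (at≤ p n n≤N) (at≤ r n n≤N)

  ⊕-cong[] : ∀ {f f′ g g′} → f ≋[ N ] f′ → g ≋[ N ] g′ → f ⊕ g ≋[ N ] f′ ⊕ g′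
  ⊕-cong[] p r = upTo λ n n≤N →
    trans (⊕-at _ _ n) (trans (cong₂ ℤ._+_ (at≤ p n n≤N) (at≤ r n n≤N)) (sym (⊕-at _ _ n)))

  ⊝-cong[] : ∀ {f g} → f ≋[ N ] g → ⊝ f ≋[ N ] ⊝ g
  ⊝-cong[] p = upTo λ n n≤N →
    trans (⊝-at _ n) (trans (cong ℤ.-_ (at≤ p n n≤N)) (sym (⊝-at _ n)))

  ·-cong[] : ∀ {f f′ g g′} → f ≋[ N ] f′ → g ≋[ N ] g′ → f · g ≋[ N ] f′ · g′
  ·-cong[] p r = upTo λ n n≤N → ·-cong≤ n
    (λ k k≤n → at≤ p k (ℕₚ.≤-trans k≤n n≤N)) (λ k k≤n → at≤ r k (ℕₚ.≤-trans k≤n n≤N))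

  ^-cong[] : ∀ {f g} n → f ≋[ N ] g → f ↑ n ≋[ N ] g ↑ n
  ^-cong[] zero    p = []-refl
  ^-cong[] (suc n) p = ·-cong[] p (^-cong[] n p)

  -- From 1/f = (1/f) g (1/g), where the middle g may be replaced by f up to order N.
  invS-cong[] : ∀ {f g} → f 0 ≡ 1ℤ → g 0 ≡ 1ℤ → f ≋[ N ] g → invS f ≋[ N ] invS g
  invS-cong[] {f} {g} f0≡1 g0≡1 p = []-trans
    (≋⇒≋[] (≋-trans (≋-sym (·-identityʳ (invS f))) (·-congˡ (≋-sym (·-inverseʳ g g0≡1)))))
    ([]-trans (·-cong[] {invS f} []-refl (·-cong[] {g = invS g} ([]-sym p) []-refl))
    (≋⇒≋[] (≋-trans (solve 3 (λ f f′ g′ → f′ :* (f :* g′) := f :* f′ :* g′) ≋-refl f (invS f) (invS g))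
      (≋-trans (·-congʳ (·-inverseʳ f f0≡1)) (·-identityˡ (invS g))))))

-- Takes the place of a limit: a finite identity that holds to every prescribed order becomes an
-- identity of infinite sums and products.
all-≋[] : ∀ {f g} → (∀ N → f ≋[ N ] g) → f ≋ g
all-≋[] p = pointwise λ n → at≤ (p n) n ℕₚ.≤-refl

q^≋[]0 : ∀ d {N} f → N < d → q ↑ d · f ≋[ N ] ι 0ℤ
q^≋[]0 d f N<d = upTo λ n n≤N →
  trans (sym (at (shiftS≋ d f) n)) (trans (go d n (ℕₚ.≤-<-trans n≤N N<d)) (sym (ι0 n)))
  where
  go : ∀ d n → n < d → shiftS d f n ≡ 0ℤ
  go (suc d) zero    _         = refl
  go (suc d) (suc n) (s≤s n<d) = go d n n<d

-- The products E_j and their finite approximations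

oneMinusQ≋ : ∀ d → oneMinusQ (suc d) ≋ ι 1ℤ ⊕ ⊝ (q ↑ suc d)
oneMinusQ≋ d = pointwise λ n → trans (go n)
    (sym (trans (⊕-at (ι 1ℤ) (⊝ (q ↑ suc d)) n) (cong (λ z → ι 1ℤ n ℤ.+ z) (⊝-at (q ↑ suc d) n))))
  where
  q^-at : ∀ d n → (q ↑ d) n ≡ (if n ℕ.≡ᵇ d then 1ℤ else 0ℤ)
  q^-at zero    zero    = ι-zero 1ℤ
  q^-at zero    (suc n) = ι-suc 1ℤ n
  q^-at (suc d) zero    = q-zero (q ↑ d)
  q^-at (suc d) (suc n) = trans (q· (q ↑ d) n) (q^-at d n)
  if-neg : ∀ b → (if b then ℤ.- 1ℤ else 0ℤ) ≡ ℤ.- (if b then 1ℤ else 0ℤ)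
  if-neg false = refl
  if-neg true  = refl
  go : ∀ n → oneMinusQ (suc d) n ≡ ι 1ℤ n ℤ.+ (ℤ.- (q ↑ suc d) n)
  go zero    = sym (cong₂ (λ x y → x ℤ.+ (ℤ.- y)) (ι-zero 1ℤ) (q^-at (suc d) 0))
  go (suc n) = trans (cong (λ z → 0ℤ ℤ.+ z) (if-neg (n ℕ.≡ᵇ d)))
    (sym (cong₂ (λ x y → x ℤ.+ (ℤ.- y)) (ι-suc 1ℤ n) (q^-at (suc d) (suc n))))

prodE-0 : ∀ j N → prodE (suc j) N 0 ≡ 1ℤ
prodE-0 j zero    = refl
prodE-0 j (suc N) = cong (ℤ._* 1ℤ) (prodE-0 j N)

prodE-suc : ∀ j N → prodE (suc j) (suc N) ≋ prodE (suc j) N · (ι 1ℤ ⊕ ⊝ (q ↑ (suc j * suc N)))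
prodE-suc j N = ≋-trans (≋-sym (·≋⊗ _ _)) (·-congˡ {prodE (suc j) N} (oneMinusQ≋ _))

-- The factor with index N + 1 differs from 1 only at the exponent (j+1)(N+1) > N. Hence the
-- diagonal definition of `E` does give the infinite product.
prodE-stable : ∀ j {n N} → n ≤ N → prodE (suc j) N n ≡ prodE (suc j) n n
prodE-stable j {n} {N} n≤N with ℕₚ.m≤n⇒m<n∨m≡n n≤N
... | inj₂ refl = refl
prodE-stable j {n} {suc N} _ | inj₁ (s≤s n≤N) = trans
  (at≤ ([]-trans
    (≋⇒≋[] (≋-trans (prodE-suc j N)
      (solve 2 (λ p x → p :* (con 1ℤ :- x) := p :- x :* p) ≋-refl (prodE (suc j) N) (q ↑ d))))
    ([]-trans (⊕-cong[] []-refl (⊝-cong[] (q^≋[]0 d (prodE (suc j) N) n<d)))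
      (≋⇒≋[] (solve 1 (λ p → p :- con 0ℤ := p) ≋-refl (prodE (suc j) N)))))
    n ℕₚ.≤-refl)
  (prodE-stable j n≤N)
  where
  d : ℕ
  d = suc j * suc N
  n<d : n < d
  n<d = ℕₚ.≤-trans (s≤s n≤N) (ℕₚ.m≤n*m (suc N) (suc j))

prodE≋[]E : ∀ j {n N} → n ≤ N → prodE (suc j) N ≋[ n ] E (suc j)
prodE≋[]E j n≤N = upTo λ k k≤n → prodE-stable j (ℕₚ.≤-trans k≤n n≤N)

-- Jacobi's identity

module ℕ+ = CommutativeSemigroupProperties ℕₚ.+-commutativeSemigroup

⨁≤ : ℕ → (ℕ → PS) → PS
⨁≤ zero    f = f 0
⨁≤ (suc n) f = ⨁≤ n f ⊕ f (suc n)

⨁-cong≤ : ∀ n {f g} → (∀ k → k ≤ n → f k ≋ g k) → ⨁≤ n f ≋ ⨁≤ n g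
⨁-cong≤ zero    h = h 0 z≤n
⨁-cong≤ (suc n) h = ⊕-cong (⨁-cong≤ n λ k k≤n → h k (ℕₚ.m≤n⇒m≤1+n k≤n)) (h (suc n) ℕₚ.≤-refl)

⨁-cong[] : ∀ {N} n {f g} → (∀ k → k ≤ n → f k ≋[ N ] g k) → ⨁≤ n f ≋[ N ] ⨁≤ n g
⨁-cong[] zero    h = h 0 z≤n
⨁-cong[] (suc n) h =
  ⊕-cong[] (⨁-cong[] n λ k k≤n → h k (ℕₚ.m≤n⇒m≤1+n k≤n)) (h (suc n) ℕₚ.≤-refl)

⨁-distribˡ : ∀ n c f → c · ⨁≤ n f ≋ ⨁≤ n (λ k → c · f k)
⨁-distribˡ zero    c f = ≋-refl
⨁-distribˡ (suc n) c f = ≋-trans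
  (solve 3 (λ c x y → c :* (x :+ y) := c :* x :+ c :* y) ≋-refl c (⨁≤ n f) (f (suc n)))
  (⊕-congʳ (⨁-distribˡ n c f))

odd : ℕ → ℤ
odd zero    = 1ℤ
odd (suc k) = + 2 ℤ.+ odd k

-- (-1)^k q^(k(k+1)/2)
theta : ℕ → PS
theta zero    = ι 1ℤ
theta (suc k) = ⊝ (q ↑ suc k · theta k)

jacobiSum : ℕ → PS
jacobiSum K = ⨁≤ K (λ k → ι (odd k) · theta k)

-- invFactorial (m + 1) = 1/(q;q)_m; the value 0 at index 0 stands for 1/(q;q)_{-1}.
invFactorial : ℕ → PS
invFactorial zero    = ι 0ℤ
invFactorial (suc m) = invS (prodE 1 m)

prodE₁-suc : ∀ N → prodE 1 (suc N) ≋ prodE 1 N · (ι 1ℤ ⊕ ⊝ (q ↑ suc N))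
prodE₁-suc N = ≋-trans (prodE-suc 0 N)
  (≋-reflexive (cong (λ d → prodE 1 N · (ι 1ℤ ⊕ ⊝ (q ↑ d))) (ℕₚ.*-identityˡ (suc N))))

-- For m ≥ 1 this is 1/(q;q)_{m-1} = (1 - q^m)/(q;q)_m. At m = 0 the factor 1 - q^0 is zero, which
-- is what makes 0 the right value at index 0.
invFactorial-step : ∀ m → invFactorial m ≋ (ι 1ℤ ⊕ ⊝ (q ↑ m)) · invFactorial (suc m)
invFactorial-step zero    = solve 1 (λ x → con 0ℤ := (con 1ℤ :- con 1ℤ) :* x) ≋-refl (invS (prodE 1 0))
invFactorial-step (suc m) = inverse-unique (·-inverseʳ (prodE 1 m) (prodE-0 0 m)) (begin
  prodE 1 m · ((ι 1ℤ ⊕ ⊝ (q ↑ suc m)) · invS (prodE 1 (suc m)))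
    ≈⟨ ·-assoc (prodE 1 m) _ _ ⟨
  prodE 1 m · (ι 1ℤ ⊕ ⊝ (q ↑ suc m)) · invS (prodE 1 (suc m))
    ≈⟨ ·-congʳ (prodE₁-suc m) ⟨
  prodE 1 (suc m) · invS (prodE 1 (suc m))
    ≈⟨ ·-inverseʳ (prodE 1 (suc m)) (prodE-0 0 (suc m)) ⟩
  ι 1ℤ ∎)
  where open ≋-Reasoning

-- Up to sign, the coefficient of z^(k+1) in ∏_{i=0}^{n} (1 - z q^i) ∏_{i=1}^{n} (1 - q^i/z),
-- divided by (q;q)_{2n+1}.
term : ℕ → ℕ → PS
term n k = theta k · invFactorial (suc n ∸ k) · invFactorial (suc (suc (n + k)))

-- For k > n the truncated subtraction in `term` lands on index 0, where `invFactorial` is 0.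
term-zero : ∀ n k → n < k → term n k ≋ ι 0ℤ
term-zero n k n<k = ≋-trans
  (≋-reflexive (cong (λ i → theta k · invFactorial i · invFactorial (suc (suc (n + k))))
    (ℕₚ.m≤n⇒m∸n≡0 n<k)))
  (solve 2 (λ x y → x :* con 0ℤ :* y := con 0ℤ) ≋-refl (theta k) (invFactorial (suc (suc (n + k)))))

term-at : ∀ n k {i j} → suc n ∸ k ≡ i → suc (suc (n + k)) ≡ j →
          term n k ≋ theta k · invFactorial i · invFactorial j
term-at n k refl refl = ≋-refl

-- Multiplication by (1 - z Q)(1 - Q/z), read on coefficients.
step : PS → PS → PS → PS → PS
step Q x y z = (ι 1ℤ ⊕ Q · Q) · y ⊕ ⊝ (Q · (x ⊕ z))

step-cong : ∀ {Q Q′ x x′ y y′ z z′} → Q ≋ Q′ → x ≋ x′ → y ≋ y′ → z ≋ z′ →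
            step Q x y z ≋ step Q′ x′ y′ z′
step-cong p a b c =
  ⊕-cong (·-cong (⊕-congˡ (·-cong p p)) b) (⊝-cong (·-cong p (⊕-cong a c)))

-- At Q = q^(n+1) this is (1 - q^(2n+2))(1 - q^(2n+3)), the ratio of the normalisations (q;q)_{2n+3}
-- and (q;q)_{2n+1} of `term (suc n)` and `term n`.
quadratic : PS → PS
quadratic Q = (ι 1ℤ ⊕ ⊝ (Q · Q)) · (ι 1ℤ ⊕ ⊝ (q · (Q · Q)))

quadratic-cong : ∀ {Q Q′} → Q ≋ Q′ → quadratic Q ≋ quadratic Q′
quadratic-cong p = ·-cong (⊕-congˡ (⊝-cong (·-cong p p))) (⊕-congˡ (⊝-cong (·-congˡ (·-cong p p))))

invFactorial-step² : ∀ m → invFactorial m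
  ≋ (ι 1ℤ ⊕ ⊝ (q ↑ m)) · (ι 1ℤ ⊕ ⊝ (q ↑ suc m)) · invFactorial (suc (suc m))
invFactorial-step² m = ≋-trans (invFactorial-step m)
  (≋-trans (·-congˡ (invFactorial-step (suc m))) (≋-sym (·-assoc _ _ _)))

-- The left neighbour of d k. Substituting 1/z for z multiplies the finite product by -1/z, so the
-- coefficients of z^(k+1) and z^(-k) are opposite; at k = 0 this supplies d(-1) = - d 0.
before : (ℕ → PS) → ℕ → PS
before d zero    = ⊝ d 0
before d (suc k) = d k

-- With n = k + 1 + r every exponent is a sum, so all powers of q become monomials in q, x = q^k and
-- y = q^r. Once all terms are brought to the common denominators behind Z and Y, the recurrence is
-- a polynomial identity. The case r = 0 is included because `invFactorial 0` is 0.
recurrence-interior : ∀ k r → let n = suc k + r in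
  quadratic (q ↑ suc n) · term (suc n) (suc k)
    ≋ step (q ↑ suc n) (term n k) (term n (suc k)) (term n (suc (suc k)))
recurrence-interior k r = begin
  quadratic (q ↑ suc n) · term (suc n) (suc k)
    ≈⟨ ·-cong (quadratic-cong Q≋) (term-at (suc n) (suc k) (e₁ 2) (cong (λ i → suc (suc (suc i))) j₁)) ⟩
  quadratic (q · (q · (x · y))) · (⊝ (q · x · s) · Z · Y)
    ≈⟨ solve 6 (λ s q x y Z Y →
         let Q = q :* (q :* (x :* y))
             1- : _ → _
             1- a = con 1ℤ :- a
             s₁ = :- (q :* x :* s)
             b = q :* (q :* (q :* (x :* (x :* y))))
         in  1- (Q :* Q) :* 1- (q :* (Q :* Q)) :* (s₁ :* Z :* Y)
             := (con 1ℤ :+ Q :* Q) :* (s₁ :* (1- (q :* y) :* Z) :* (1- (q :* b) :* Y))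
                :- Q :* (s :* Z :* (1- b :* 1- (q :* b) :* Y)
                         :+ :- (q :* (q :* x) :* s₁) :* (1- y :* 1- (q :* y) :* Z) :* Y))
         ≋-refl s q x y Z Y ⟩
  step (q · (q · (x · y)))
       (s · Z · ((ι 1ℤ ⊕ ⊝ b) · (ι 1ℤ ⊕ ⊝ (q · b)) · Y))
       (⊝ (q · x · s) · ((ι 1ℤ ⊕ ⊝ (q · y)) · Z) · ((ι 1ℤ ⊕ ⊝ (q · b)) · Y))
       (⊝ (q · (q · x) · ⊝ (q · x · s)) · ((ι 1ℤ ⊕ ⊝ y) · (ι 1ℤ ⊕ ⊝ (q · y)) · Z) · Y)
    ≈⟨ step-cong Q≋
         (≋-trans (term-at n k (e₁ 2) (cong (λ i → suc (suc i)) j₀))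
            (·-congˡ (≋-trans (invFactorial-step² (suc (suc (suc c))))
              (·-congʳ (·-cong (⊕-congˡ (⊝-cong b≋)) (⊕-congˡ (⊝-cong (·-congˡ b≋))))))))
         (≋-trans (term-at n (suc k) (e₁ 1) (cong (λ i → suc (suc i)) j₁))
            (·-cong (·-congˡ (invFactorial-step (suc r)))
              (≋-trans (invFactorial-step (suc (suc (suc (suc c))))) (·-congʳ (⊕-congˡ (⊝-cong (·-congˡ b≋)))))))
         (≋-trans (term-at n (suc (suc k)) (e₁ 0) (cong (λ i → suc (suc i)) j₂))
            (·-congʳ (·-congˡ (invFactorial-step² r)))) ⟨
  step (q ↑ suc n) (term n k) (term n (suc k)) (term n (suc (suc k))) ∎
  where
  open ≋-Reasoning
  n : ℕ
  n = suc k + r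
  c : ℕ
  c = k + (k + r)
  s x y Z Y b : PS
  s = theta k
  x = q ↑ k
  y = q ↑ r
  Z = invFactorial (suc (suc r))
  Y = invFactorial (suc (suc (suc (suc (suc c)))))
  b = q · (q · (q · (x · (x · y))))
  Q≋ : q ↑ suc n ≋ q · (q · (x · y))
  Q≋ = ·-congˡ (·-congˡ (^-homo-* q k r))
  b≋ : q ↑ suc (suc (suc c)) ≋ b
  b≋ = ·-congˡ (·-congˡ (·-congˡ (≋-trans (^-homo-* q k (k + r)) (·-congˡ (^-homo-* q k r)))))
  e₁ : ∀ i → (i + (k + r)) ∸ k ≡ i + r
  e₁ i = trans (cong (_∸ k) (ℕ+.x∙yz≈y∙xz i k r)) (ℕₚ.m+n∸m≡n k (i + r))
  j₀ : n + k ≡ suc c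
  j₀ = cong suc (ℕₚ.+-comm (k + r) k)
  j₁ : n + suc k ≡ suc (suc c)
  j₁ = trans (ℕₚ.+-suc n k) (cong suc j₀)
  j₂ : n + suc (suc k) ≡ suc (suc (suc c))
  j₂ = trans (ℕₚ.+-suc n (suc k)) (cong suc j₁)

-- The lower end, where the left neighbour comes from the antisymmetry of the coefficients.
recurrence-first : ∀ n → quadratic (q ↑ suc n) · term (suc n) 0
  ≋ step (q ↑ suc n) (⊝ term n 0) (term n 0) (term n 1)
recurrence-first n = begin
  quadratic (q · y) · term (suc n) 0
    ≈⟨ ·-congˡ (term-at (suc n) 0 refl (cong (λ i → suc (suc (suc i))) (ℕₚ.+-identityʳ n))) ⟩
  quadratic (q · y) · (ι 1ℤ · Z · Y)
    ≈⟨ solve 4 (λ q y Z Y →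
         let Q = q :* y
             1- : _ → _
             1- a = con 1ℤ :- a
             d = con 1ℤ :* (1- Q :* Z) :* (1- (q :* Q) :* Y)
         in  1- (Q :* Q) :* 1- (q :* (Q :* Q)) :* (con 1ℤ :* Z :* Y)
             := (con 1ℤ :+ Q :* Q) :* d
                :- Q :* (:- d :+ :- (q :* con 1ℤ :* con 1ℤ) :* (1- y :* 1- Q :* Z) :* Y))
         ≋-refl q y Z Y ⟩
  step (q · y) (⊝ d) d (⊝ (q · ι 1ℤ · ι 1ℤ) · ((ι 1ℤ ⊕ ⊝ y) · (ι 1ℤ ⊕ ⊝ (q · y)) · Z) · Y)
    ≈⟨ step-cong ≋-refl (⊝-cong d≋) d≋
         (≋-trans (term-at n 1 refl (cong (λ i → suc (suc i)) (ℕₚ.+-comm n 1)))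
           (·-congʳ (·-congˡ (invFactorial-step² n)))) ⟨
  step (q · y) (⊝ term n 0) (term n 0) (term n 1) ∎
  where
  open ≋-Reasoning
  y Z Y d : PS
  y = q ↑ n
  Z = invFactorial (suc (suc n))
  Y = invFactorial (suc (suc (suc n)))
  d = ι 1ℤ · ((ι 1ℤ ⊕ ⊝ (q · y)) · Z) · ((ι 1ℤ ⊕ ⊝ (q · (q · y))) · Y)
  d≋ : term n 0 ≋ d
  d≋ = ≋-trans (term-at n 0 refl (cong (λ i → suc (suc i)) (ℕₚ.+-identityʳ n)))
    (·-cong (·-congˡ (invFactorial-step (suc n))) (invFactorial-step (suc (suc n))))

-- The upper end: k = n + 1 lies beyond the support of `term n`, and only the left neighbour
-- survives.
recurrence-last : ∀ n → quadratic (q ↑ suc n) · term (suc n) (suc n)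
  ≋ step (q ↑ suc n) (term n n) (term n (suc n)) (term n (suc (suc n)))
recurrence-last n = begin
  quadratic Q · term (suc n) (suc n)
    ≈⟨ ·-congˡ (term-at (suc n) (suc n) e j₂) ⟩
  quadratic Q · (⊝ (Q · s) · Z · Y)
    ≈⟨ solve 5 (λ s q Q Z Y →
         let 1- : _ → _
             1- a = con 1ℤ :- a
         in  1- (Q :* Q) :* 1- (q :* (Q :* Q)) :* (:- (Q :* s) :* Z :* Y)
             := (con 1ℤ :+ Q :* Q) :* con 0ℤ
                :- Q :* (s :* Z :* (1- (Q :* Q) :* 1- (q :* (Q :* Q)) :* Y) :+ con 0ℤ))
         ≋-refl s q Q Z Y ⟩
  step Q (s · Z · ((ι 1ℤ ⊕ ⊝ (Q · Q)) · (ι 1ℤ ⊕ ⊝ (q · (Q · Q))) · Y)) (ι 0ℤ) (ι 0ℤ)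
    ≈⟨ step-cong ≋-refl
         (≋-trans (term-at n n e j₀) (·-congˡ (≋-trans (invFactorial-step² c)
           (·-congʳ (·-cong (⊕-congˡ (⊝-cong Q²≋)) (⊕-congˡ (⊝-cong (·-congˡ Q²≋))))))))
         (term-zero n (suc n) ℕₚ.≤-refl) (term-zero n (suc (suc n)) (ℕₚ.m≤n⇒m≤1+n ℕₚ.≤-refl)) ⟨
  step Q (term n n) (term n (suc n)) (term n (suc (suc n))) ∎
  where
  open ≋-Reasoning
  c : ℕ
  c = suc n + suc n
  s Q Z Y : PS
  s = theta n
  Q = q ↑ suc n
  Z = invFactorial 1
  Y = invFactorial (suc (suc c))
  Q²≋ : q ↑ c ≋ Q · Q
  Q²≋ = ^-homo-* q (suc n) (suc n)
  e : suc n ∸ n ≡ 1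
  e = ℕₚ.m+n∸n≡m 1 n
  j₀ : suc (suc (n + n)) ≡ c
  j₀ = cong suc (sym (ℕₚ.+-suc n n))
  j₂ : suc (suc (suc n + suc n)) ≡ suc (suc c)
  j₂ = refl

recurrence : ∀ n k → k ≤ suc n → quadratic (q ↑ suc n) · term (suc n) k
  ≋ step (q ↑ suc n) (before (term n) k) (term n k) (term n (suc k))
recurrence n zero    _         = recurrence-first n
recurrence n (suc k) (s≤s k≤n) with ℕₚ.m≤n⇒m<n∨m≡n k≤n
... | inj₂ refl = recurrence-last n
... | inj₁ k<n  = subst
  (λ n → quadratic (q ↑ suc n) · term (suc n) (suc k)
    ≋ step (q ↑ suc n) (term n k) (term n (suc k)) (term n (suc (suc k))))
  (ℕₚ.m+[n∸m]≡n k<n) (recurrence-interior k (n ∸ suc k))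

-- The weights 2k + 1 make the second difference telescope.
weighted-step : ∀ Q d K →
  ⨁≤ K (λ k → ι (odd k) · step Q (before d k) (d k) (d (suc k)))
  ≋ (ι 1ℤ ⊕ ⊝ Q) ↑ 2 · ⨁≤ K (λ k → ι (odd k) · d k)
    ⊕ Q · (ι (odd (suc K)) · d K ⊕ ⊝ (ι (odd K) · d (suc K)))
weighted-step Q d zero = solve 3 (λ Q x y →
    con 1ℤ :* ((con 1ℤ :+ Q :* Q) :* x :- Q :* (:- x :+ y))
    := (con 1ℤ :- Q) :^ 2 :* (con 1ℤ :* x) :+ Q :* (con (+ 3) :* x :- con 1ℤ :* y))
  ≋-refl Q (d 0) (d 1)
weighted-step Q d (suc K) = begin
  ⨁≤ K _ ⊕ ι (odd (suc K)) · step Q (d K) (d (suc K)) (d (suc (suc K)))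
    ≈⟨ ⊕-cong (weighted-step Q d K) (·-congʳ (ι-+ (+ 2) (odd K))) ⟩
  (ι 1ℤ ⊕ ⊝ Q) ↑ 2 · S ⊕ Q · (ι (odd (suc K)) · d K ⊕ ⊝ (ι (odd K) · d (suc K)))
    ⊕ (ι (+ 2) ⊕ w) · step Q (d K) (d (suc K)) (d (suc (suc K)))
    ≈⟨ ⊕-congʳ (⊕-congˡ (·-congˡ (⊕-congʳ (·-congʳ (ι-+ (+ 2) (odd K)))))) ⟩
  (ι 1ℤ ⊕ ⊝ Q) ↑ 2 · S ⊕ Q · ((ι (+ 2) ⊕ w) · d K ⊕ ⊝ (w · d (suc K)))
    ⊕ (ι (+ 2) ⊕ w) · step Q (d K) (d (suc K)) (d (suc (suc K)))
    ≈⟨ solve 6 (λ Q S w x y z →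
         (con 1ℤ :- Q) :^ 2 :* S :+ Q :* ((con (+ 2) :+ w) :* x :- w :* y)
         :+ (con (+ 2) :+ w) :* ((con 1ℤ :+ Q :* Q) :* y :- Q :* (x :+ z))
         := (con 1ℤ :- Q) :^ 2 :* (S :+ (con (+ 2) :+ w) :* y)
            :+ Q :* ((con (+ 2) :+ (con (+ 2) :+ w)) :* y :- (con (+ 2) :+ w) :* z))
       ≋-refl Q S w (d K) (d (suc K)) (d (suc (suc K))) ⟩
  (ι 1ℤ ⊕ ⊝ Q) ↑ 2 · (S ⊕ (ι (+ 2) ⊕ w) · d (suc K))
    ⊕ Q · ((ι (+ 2) ⊕ (ι (+ 2) ⊕ w)) · d (suc K) ⊕ ⊝ ((ι (+ 2) ⊕ w) · d (suc (suc K))))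
    ≈⟨ ⊕-cong (·-congˡ (⊕-congˡ (·-congʳ (ι-+ (+ 2) (odd K)))))
         (·-congˡ (⊕-cong
           (·-congʳ (≋-trans (ι-+ (+ 2) (odd (suc K))) (⊕-congˡ (ι-+ (+ 2) (odd K)))))
           (⊝-cong (·-congʳ (ι-+ (+ 2) (odd K)))))) ⟨
  (ι 1ℤ ⊕ ⊝ Q) ↑ 2 · ⨁≤ (suc K) (λ k → ι (odd k) · d k)
    ⊕ Q · (ι (odd (suc (suc K))) · d (suc K) ⊕ ⊝ (ι (odd (suc K)) · d (suc (suc K)))) ∎
  where
  open ≋-Reasoning
  S w : PS
  S = ⨁≤ K (λ k → ι (odd k) · d k)
  w = ι (odd K)

finiteSum : ℕ → PS
finiteSum n = ⨁≤ n (λ k → ι (odd k) · term n k)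

-- The boundary term of `weighted-step` vanishes because `term n` is zero beyond n. The remaining (1
-- - Q)² is the value of (1 - zQ)(1 - Q/z) at z = 1.
finiteSum-step : ∀ n → quadratic (q ↑ suc n) · finiteSum (suc n)
  ≋ (ι 1ℤ ⊕ ⊝ (q ↑ suc n)) ↑ 2 · finiteSum n
finiteSum-step n = begin
  quadratic Q · finiteSum (suc n)
    ≈⟨ ⨁-distribˡ (suc n) (quadratic Q) _ ⟩
  ⨁≤ (suc n) (λ k → quadratic Q · (ι (odd k) · term (suc n) k))
    ≈⟨ ⨁-cong≤ (suc n) (λ k k≤ → ≋-trans
         (solve 3 (λ x y z → x :* (y :* z) := y :* (x :* z)) ≋-refl
           (quadratic Q) (ι (odd k)) (term (suc n) k))
         (·-congˡ (recurrence n k k≤))) ⟩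
  ⨁≤ (suc n) (λ k → ι (odd k) · step Q (before (term n) k) (term n k) (term n (suc k)))
    ≈⟨ weighted-step Q (term n) (suc n) ⟩
  c · ⨁≤ (suc n) (λ k → ι (odd k) · term n k)
    ⊕ Q · (w′ · term n (suc n) ⊕ ⊝ (w · term n (suc (suc n))))
    ≈⟨ ⊕-cong (·-congˡ (⊕-congˡ (·-congˡ z₁))) (·-congˡ (⊕-cong (·-congˡ z₁) (⊝-cong (·-congˡ z₂)))) ⟩
  c · (finiteSum n ⊕ w · ι 0ℤ) ⊕ Q · (w′ · ι 0ℤ ⊕ ⊝ (w · ι 0ℤ))
    ≈⟨ solve 5 (λ Q c s w w′ → c :* (s :+ w :* con 0ℤ) :+ Q :* (w′ :* con 0ℤ :- w :* con 0ℤ) := c :* s)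
         ≋-refl Q c (finiteSum n) w w′ ⟩
  c · finiteSum n ∎
  where
  open ≋-Reasoning
  Q c w w′ : PS
  Q = q ↑ suc n
  c = (ι 1ℤ ⊕ ⊝ Q) ↑ 2
  w = ι (odd (suc n))
  w′ = ι (odd (suc (suc n)))
  z₁ : term n (suc n) ≋ ι 0ℤ
  z₁ = term-zero n (suc n) ℕₚ.≤-refl
  z₂ : term n (suc (suc n)) ≋ ι 0ℤ
  z₂ = term-zero n (suc (suc n)) (ℕₚ.m≤n⇒m≤1+n ℕₚ.≤-refl)

-- Up to sign, the derivative of the finite product at its simple zero z = 1: the factor 1 - z is
-- removed and the other factors give (q;q)_n twice.
finiteJacobi : ∀ n → finiteSum n · prodE 1 (suc (n + n)) ≋ prodE 1 n ↑ 2
finiteJacobi zero = begin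
  ι 1ℤ · (ι 1ℤ · invS (prodE 1 0) · invS (prodE 1 1)) · prodE 1 1
    ≈⟨ solve 3 (λ a b c → con 1ℤ :* (con 1ℤ :* a :* b) :* c := c :* b :* a)
         ≋-refl (invS (prodE 1 0)) (invS (prodE 1 1)) (prodE 1 1) ⟩
  prodE 1 1 · invS (prodE 1 1) · invS (prodE 1 0)
    ≈⟨ ·-congʳ (·-inverseʳ (prodE 1 1) (prodE-0 0 1)) ⟩
  ι 1ℤ · invS (prodE 1 0)
    ≈⟨ ·-congʳ oneS≋1 ⟨
  prodE 1 0 · invS (prodE 1 0)
    ≈⟨ ·-inverseʳ (prodE 1 0) (prodE-0 0 0) ⟩
  ι 1ℤ
    ≈⟨ solve 0 (con 1ℤ :^ 2 := con 1ℤ) ≋-refl ⟨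
  ι 1ℤ ↑ 2
    ≈⟨ ^-congˡ 2 oneS≋1 ⟨
  prodE 1 0 ↑ 2 ∎
  where open ≋-Reasoning
finiteJacobi (suc n) = begin
  finiteSum (suc n) · prodE 1 (suc (suc n + suc n))
    ≈⟨ ·-congˡ expand ⟩
  finiteSum (suc n) · (prodE 1 (suc (n + n)) · (ι 1ℤ ⊕ ⊝ (Q · Q)) · (ι 1ℤ ⊕ ⊝ (q · (Q · Q))))
    ≈⟨ solve 4 (λ w p a b → w :* (p :* a :* b) := a :* b :* w :* p)
         ≋-refl (finiteSum (suc n)) (prodE 1 (suc (n + n))) (ι 1ℤ ⊕ ⊝ (Q · Q)) (ι 1ℤ ⊕ ⊝ (q · (Q · Q))) ⟩
  quadratic Q · finiteSum (suc n) · prodE 1 (suc (n + n))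
    ≈⟨ ·-congʳ (finiteSum-step n) ⟩
  (ι 1ℤ ⊕ ⊝ Q) ↑ 2 · finiteSum n · prodE 1 (suc (n + n))
    ≈⟨ ·-assoc _ _ _ ⟩
  (ι 1ℤ ⊕ ⊝ Q) ↑ 2 · (finiteSum n · prodE 1 (suc (n + n)))
    ≈⟨ ·-congˡ (finiteJacobi n) ⟩
  (ι 1ℤ ⊕ ⊝ Q) ↑ 2 · prodE 1 n ↑ 2
    ≈⟨ solve 2 (λ a b → a :^ 2 :* b :^ 2 := (b :* a) :^ 2) ≋-refl (ι 1ℤ ⊕ ⊝ Q) (prodE 1 n) ⟩
  (prodE 1 n · (ι 1ℤ ⊕ ⊝ Q)) ↑ 2
    ≈⟨ ^-congˡ 2 (prodE₁-suc n) ⟨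
  prodE 1 (suc n) ↑ 2 ∎
  where
  open ≋-Reasoning
  Q : PS
  Q = q ↑ suc n
  Q² : q ↑ (suc n + suc n) ≋ Q · Q
  Q² = ^-homo-* q (suc n) (suc n)
  expand : prodE 1 (suc (suc n + suc n))
    ≋ prodE 1 (suc (n + n)) · (ι 1ℤ ⊕ ⊝ (Q · Q)) · (ι 1ℤ ⊕ ⊝ (q · (Q · Q)))
  expand = begin
    prodE 1 (suc (suc n + suc n))
      ≈⟨ prodE₁-suc (suc n + suc n) ⟩
    prodE 1 (suc n + suc n) · (ι 1ℤ ⊕ ⊝ (q · q ↑ (suc n + suc n)))
      ≈⟨ ·-cong (prodE₁-suc (n + suc n)) (⊕-congˡ (⊝-cong (·-congˡ Q²))) ⟩
    prodE 1 (n + suc n) · (ι 1ℤ ⊕ ⊝ (q ↑ (suc n + suc n))) · (ι 1ℤ ⊕ ⊝ (q · (Q · Q)))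
      ≈⟨ ·-congʳ (·-cong (≋-reflexive (cong (prodE 1) (ℕₚ.+-suc n n))) (⊕-congˡ (⊝-cong Q²))) ⟩
    prodE 1 (suc (n + n)) · (ι 1ℤ ⊕ ⊝ (Q · Q)) · (ι 1ℤ ⊕ ⊝ (q · (Q · Q))) ∎

theta≋[]0 : ∀ {N} k → N < k → theta k ≋[ N ] ι 0ℤ
theta≋[]0 {N} (suc k) N<k = []-trans (⊝-cong[] (q^≋[]0 (suc k) (theta k) N<k))
  (≋⇒≋[] (solve 0 (:- con 0ℤ := con 0ℤ) ≋-refl))

jacobiSum-stable : ∀ N i → jacobiSum (i + N) ≋[ N ] jacobiSum N
jacobiSum-stable N zero    = []-refl
jacobiSum-stable N (suc i) = []-trans
  (⊕-cong[] (jacobiSum-stable N i) (·-cong[] {f = ι _} []-refl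
    (theta≋[]0 (suc (i + N)) (s≤s (ℕₚ.m≤n+m N i)))))
  (≋⇒≋[] (solve 2 (λ x y → x :+ y :* con 0ℤ := x) ≋-refl (jacobiSum N) (ι (odd (suc (i + N))))))

v : PS
v = invS (E 1)

E·v : E 1 · v ≋ ι 1ℤ
E·v = ·-inverseʳ (E 1) refl

invFactorial≋[]v : ∀ {N m} → N ≤ m → invFactorial (suc m) ≋[ N ] v
invFactorial≋[]v {m = m} N≤m = invS-cong[] (prodE-0 0 m) refl (prodE≋[]E 0 N≤m)

-- In `finiteJacobi` both denominators of `term` tend to E₁, so the sum tends to v² times Jacobi's
-- sum, while the finite products tend to E₁ and E₁². Multiplying by E₁² and cancelling with v
-- leaves E₁³.
jacobi≤ : ∀ N → jacobiSum N ≋[ N ] E 1 ↑ 3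
jacobi≤ N = []-trans (≋⇒≋[] (begin
    jacobiSum N
      ≈⟨ ≋-trans (≋-sym (·-identityʳ _)) (·-congˡ one) ⟩
    jacobiSum N · ((E 1 · v) ↑ 3)
      ≈⟨ solve 3 (λ j e v → j :* (e :* v) :^ 3 := (v :^ 2 :* j) :* e :* (e :^ 2 :* v)) ≋-refl
           (jacobiSum N) (E 1) v ⟩
    v ↑ 2 · jacobiSum N · E 1 · (E 1 ↑ 2 · v) ∎))
  ([]-trans (·-cong[] {g = E 1 ↑ 2 · v} main []-refl) (≋⇒≋[] (begin
    E 1 ↑ 2 · (E 1 ↑ 2 · v)
      ≈⟨ solve 2 (λ e v → e :^ 2 :* (e :^ 2 :* v) := e :^ 3 :* (e :* v)) ≋-refl (E 1) v ⟩
    E 1 ↑ 3 · (E 1 · v)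
      ≈⟨ ·-congˡ E·v ⟩
    E 1 ↑ 3 · ι 1ℤ
      ≈⟨ ·-identityʳ _ ⟩
    E 1 ↑ 3 ∎)))
  where
  open ≋-Reasoning
  one : ι 1ℤ ≋ (E 1 · v) ↑ 3
  one = ≋-trans (solve 0 (con 1ℤ := con 1ℤ :^ 3) ≋-refl) (^-congˡ 3 (≋-sym E·v))
  -- With n = 2N, every k ≤ N has n - k ≥ N, so both denominators agree with E₁ to order N; for k >
  -- N the factor `theta k` is already zero to that order.
  n : ℕ
  n = N + N
  approx : ∀ k → k ≤ n → v ↑ 2 · (ι (odd k) · theta k) ≋[ N ] ι (odd k) · term n k
  approx k k≤n with ℕₚ.≤-<-connex k N
  ... | inj₁ k≤N = []-trans
    (≋⇒≋[] (solve 3 (λ v w s → v :^ 2 :* (w :* s) := w :* (s :* v :* v)) ≋-refl v (ι (odd k)) (theta k)))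
    (·-cong[] {f = ι (odd k)} []-refl (·-cong[] (·-cong[] {f = theta k} []-refl
      (subst (λ i → v ≋[ N ] invFactorial i) (sym (ℕₚ.+-∸-assoc 1 k≤n))
        ([]-sym (invFactorial≋[]v
          (ℕₚ.≤-trans (ℕₚ.≤-reflexive (sym (ℕₚ.m+n∸n≡m N N))) (ℕₚ.∸-monoʳ-≤ n k≤N))))))
      ([]-sym (invFactorial≋[]v (ℕₚ.≤-trans (ℕₚ.m≤m+n N N) (ℕₚ.≤-trans (ℕₚ.m≤m+n n k) (ℕₚ.n≤1+n _)))))))
  ... | inj₂ N<k = []-trans
    (·-cong[] {f = v ↑ 2} []-refl (·-cong[] {f = ι (odd k)} []-refl (theta≋[]0 k N<k)))
    ([]-trans (≋⇒≋[] (solve 4 (λ v w x y → v :^ 2 :* (w :* con 0ℤ) := w :* (con 0ℤ :* x :* y)) ≋-refl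
        v (ι (odd k)) x y))
      (·-cong[] {f = ι (odd k)} []-refl
        (·-cong[] {g = y} (·-cong[] {g = x} ([]-sym (theta≋[]0 k N<k)) []-refl) []-refl)))
    where
    x y : PS
    x = invFactorial (suc n ∸ k)
    y = invFactorial (suc (suc (n + k)))
  main : v ↑ 2 · jacobiSum N · E 1 ≋[ N ] E 1 ↑ 2
  main = []-trans (·-cong[]
      ([]-trans (·-cong[] {f = v ↑ 2} []-refl ([]-sym (jacobiSum-stable N N)))
        ([]-trans (≋⇒≋[] (⨁-distribˡ n (v ↑ 2) _)) (⨁-cong[] n approx)))
      ([]-sym (prodE≋[]E 0 (ℕₚ.≤-trans (ℕₚ.m≤m+n N N) (ℕₚ.≤-trans (ℕₚ.m≤m+n n n) (ℕₚ.n≤1+n _))))))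
    ([]-trans (≋⇒≋[] (finiteJacobi n)) (^-cong[] 2 (prodE≋[]E 0 (ℕₚ.m≤m+n N N))))

-- Dissection modulo 3

part : ℕ → PS → PS
part r f n = f (r + n * 3)

-- f(q) ↦ f(q³)
dil : PS → PS
dil f zero                = f 0
dil f (suc zero)          = 0ℤ
dil f (suc (suc zero))    = 0ℤ
dil f (suc (suc (suc n))) = dil (tail f) n

part-cong : ∀ r {f g} → f ≋ g → part r f ≋ part r g
part-cong r p = pointwise λ n → at p (r + n * 3)

part-⊕ : ∀ r f g → part r (f ⊕ g) ≋ part r f ⊕ part r g
part-⊕ r f g = pointwise λ n → trans (⊕-at f g _) (sym (⊕-at (part r f) (part r g) n))

part-⊝ : ∀ r f → part r (⊝ f) ≋ ⊝ part r f
part-⊝ r f = pointwise λ n → trans (⊝-at f _) (sym (⊝-at (part r f) n))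

part₀-q : ∀ f → part 0 (q · f) ≋ q · part 2 f
part₀-q f = pointwise λ
  { zero    → trans (q-zero f) (sym (q-zero (part 2 f)))
  ; (suc n) → trans (q· f _) (sym (q· (part 2 f) n)) }

part₁-q : ∀ f → part 1 (q · f) ≋ part 0 f
part₁-q f = pointwise λ n → q· f _

part₂-q : ∀ f → part 2 (q · f) ≋ part 1 f
part₂-q f = pointwise λ n → q· f _

parts-ext : ∀ {f g} → part 0 f ≋ part 0 g → part 1 f ≋ part 1 g → part 2 f ≋ part 2 g → f ≋ g
parts-ext {f} {g} a b c = pointwise (go f g (at a) (at b) (at c))
  where
  go : ∀ f g → (∀ n → f (n * 3) ≡ g (n * 3)) → (∀ n → f (1 + n * 3) ≡ g (1 + n * 3)) →
       (∀ n → f (2 + n * 3) ≡ g (2 + n * 3)) → ∀ n → f n ≡ g n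
  go f g a b c zero                = a 0
  go f g a b c (suc zero)          = b 0
  go f g a b c (suc (suc zero))    = c 0
  go f g a b c (suc (suc (suc n))) = go (λ k → f (3 + k)) (λ k → g (3 + k))
    (λ n → a (suc n)) (λ n → b (suc n)) (λ n → c (suc n)) n

part₀-dil : ∀ f → part 0 (dil f) ≋ f
part₀-dil f = pointwise (go f)
  where
  go : ∀ f n → dil f (n * 3) ≡ f n
  go f zero    = refl
  go f (suc n) = go (tail f) n

part₁-dil : ∀ f → part 1 (dil f) ≋ ι 0ℤ
part₁-dil f = pointwise λ n → trans (go f n) (sym (ι0 n))
  where
  go : ∀ f n → dil f (1 + n * 3) ≡ 0ℤ
  go f zero    = refl
  go f (suc n) = go (tail f) n

part₂-dil : ∀ f → part 2 (dil f) ≋ ι 0ℤ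
part₂-dil f = pointwise λ n → trans (go f n) (sym (ι0 n))
  where
  go : ∀ f n → dil f (2 + n * 3) ≡ 0ℤ
  go f zero    = refl
  go f (suc n) = go (tail f) n

dil-cong≤ : ∀ n {f g} → (∀ k → k ≤ n → f k ≡ g k) → dil f n ≡ dil g n
dil-cong≤ zero                h = h 0 z≤n
dil-cong≤ (suc zero)          h = refl
dil-cong≤ (suc (suc zero))    h = refl
dil-cong≤ (suc (suc (suc n))) h =
  dil-cong≤ n λ k k≤n → h (suc k) (s≤s (ℕₚ.≤-trans k≤n (ℕₚ.m≤n+m n 2)))

dil-cong : ∀ {f g} → f ≋ g → dil f ≋ dil g
dil-cong p = pointwise λ n → dil-cong≤ n λ k _ → at p k

dil-cong[] : ∀ {N f g} → f ≋[ N ] g → dil f ≋[ N ] dil g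
dil-cong[] p = upTo λ n n≤N → dil-cong≤ n λ k k≤n → at≤ p k (ℕₚ.≤-trans k≤n n≤N)

·-suc₀ : ∀ f g n → f 0 ≡ 0ℤ → (f · g) (suc n) ≡ (tail f · g) n
·-suc₀ f g n f0≡0 = trans (·-suc f g n)
  (trans (cong (λ z → z ℤ.* g (suc n) ℤ.+ (tail f · g) n) f0≡0) (ℤₚ.+-identityˡ _))

dil·-shift : ∀ f g n → (dil f · g) (3 + n) ≡ f 0 ℤ.* g (3 + n) ℤ.+ (dil (tail f) · g) n
dil·-shift f g n = trans (·-suc (dil f) g (2 + n)) (cong (λ z → f 0 ℤ.* g (3 + n) ℤ.+ z)
  (trans (·-suc₀ (tail (dil f)) g (suc n) refl) (·-suc₀ (tail (tail (dil f))) g n refl)))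

dil·-small : ∀ f g r → r ≤ 2 → (dil f · g) r ≡ f 0 ℤ.* g r
dil·-small f g zero          _ = ·-zero (dil f) g
dil·-small f g (suc zero)    _ = trans (·-suc (dil f) g 0)
  (trans (cong (λ z → f 0 ℤ.* g 1 ℤ.+ z) (·-zero (tail (dil f)) g)) (ℤₚ.+-identityʳ _))
dil·-small f g (suc (suc zero)) _ = trans (·-suc (dil f) g 1)
  (trans (cong (λ z → f 0 ℤ.* g 2 ℤ.+ z)
    (trans (·-suc₀ (tail (dil f)) g 0 refl) (·-zero (tail (tail (dil f))) g))) (ℤₚ.+-identityʳ _))
dil·-small f g (suc (suc (suc r))) (s≤s (s≤s ()))

-- A factor in q³ moves exponents by multiples of 3 only, so it passes through the extraction. The
-- product rules `dil-·` and `part-·` both rest on this.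
part-dil· : ∀ r f g → r ≤ 2 → part r (dil f · g) ≋ f · part r g
part-dil· r f g r≤2 = pointwise (go f)
  where
  go : ∀ f n → (dil f · g) (r + n * 3) ≡ (f · part r g) n
  go f zero    = trans (cong (dil f · g) (ℕₚ.+-identityʳ r)) (trans (dil·-small f g r r≤2)
    (trans (cong (λ i → f 0 ℤ.* g i) (sym (ℕₚ.+-identityʳ r))) (sym (·-zero f (part r g)))))
  go f (suc n) = begin
    (dil f · g) (r + (3 + n * 3))
      ≡⟨ cong (dil f · g) e ⟩
    (dil f · g) (3 + (r + n * 3))
      ≡⟨ dil·-shift f g _ ⟩
    f 0 ℤ.* g (3 + (r + n * 3)) ℤ.+ (dil (tail f) · g) (r + n * 3)
      ≡⟨ cong₂ (λ i z → f 0 ℤ.* g i ℤ.+ z) (sym e) (go (tail f) n) ⟩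
    f 0 ℤ.* part r g (suc n) ℤ.+ (tail f · part r g) n
      ≡⟨ ·-suc f (part r g) n ⟨
    (f · part r g) (suc n) ∎
    where
    open ≡-Reasoning
    e : r + (3 + n * 3) ≡ 3 + (r + n * 3)
    e = ℕ+.x∙yz≈y∙xz r 3 (n * 3)

-- Characterises `dil f` by its residue parts, so that its ring laws follow from those of `part`.
dil-homo : ∀ {f g} → part 0 g ≋ f → part 1 g ≋ ι 0ℤ → part 2 g ≋ ι 0ℤ → dil f ≋ g
dil-homo {f} a b c = parts-ext (≋-trans (part₀-dil f) (≋-sym a))
  (≋-trans (part₁-dil f) (≋-sym b)) (≋-trans (part₂-dil f) (≋-sym c))

dil-⊕ : ∀ f g → dil (f ⊕ g) ≋ dil f ⊕ dil g
dil-⊕ f g = dil-homo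
  (≋-trans (part-⊕ 0 _ _) (⊕-cong (part₀-dil f) (part₀-dil g)))
  (≋-trans (part-⊕ 1 _ _) (≋-trans (⊕-cong (part₁-dil f) (part₁-dil g)) z))
  (≋-trans (part-⊕ 2 _ _) (≋-trans (⊕-cong (part₂-dil f) (part₂-dil g)) z))
  where
  z : ι 0ℤ ⊕ ι 0ℤ ≋ ι 0ℤ
  z = solve 0 (con 0ℤ :+ con 0ℤ := con 0ℤ) ≋-refl

dil-⊝ : ∀ f → dil (⊝ f) ≋ ⊝ dil f
dil-⊝ f = dil-homo
  (≋-trans (part-⊝ 0 _) (⊝-cong (part₀-dil f)))
  (≋-trans (part-⊝ 1 _) (≋-trans (⊝-cong (part₁-dil f)) z))
  (≋-trans (part-⊝ 2 _) (≋-trans (⊝-cong (part₂-dil f)) z))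
  where
  z : ⊝ ι 0ℤ ≋ ι 0ℤ
  z = solve 0 (:- con 0ℤ := con 0ℤ) ≋-refl

dil-· : ∀ f g → dil (f · g) ≋ dil f · dil g
dil-· f g = dil-homo
  (≋-trans (part-dil· 0 f (dil g) z≤n) (·-congˡ (part₀-dil g)))
  (≋-trans (part-dil· 1 f (dil g) (s≤s z≤n)) (≋-trans (·-congˡ (part₁-dil g)) z))
  (≋-trans (part-dil· 2 f (dil g) ℕₚ.≤-refl) (≋-trans (·-congˡ (part₂-dil g)) z))
  where
  z : f · ι 0ℤ ≋ ι 0ℤ
  z = solve 1 (λ f → f :* con 0ℤ := con 0ℤ) ≋-refl f

part₀-ι : ∀ c → part 0 (ι c) ≋ ι c
part₀-ι c = pointwise λ { zero → refl ; (suc n) → trans (ι-suc c _) (sym (ι-suc c n)) }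

part₁-ι : ∀ c → part 1 (ι c) ≋ ι 0ℤ
part₁-ι c = pointwise λ n → trans (ι-suc c _) (sym (ι0 n))

part₂-ι : ∀ c → part 2 (ι c) ≋ ι 0ℤ
part₂-ι c = pointwise λ n → trans (ι-suc c _) (sym (ι0 n))

dil-ι : ∀ c → dil (ι c) ≋ ι c
dil-ι c = dil-homo (part₀-ι c) (part₁-ι c) (part₂-ι c)

dil-^ : ∀ f n → dil (f ↑ n) ≋ dil f ↑ n
dil-^ f zero    = dil-ι 1ℤ
dil-^ f (suc n) = ≋-trans (dil-· f (f ↑ n)) (·-congˡ (dil-^ f n))

part-ι· : ∀ r c f → r ≤ 2 → part r (ι c · f) ≋ ι c · part r f
part-ι· r c f r≤2 = ≋-trans (part-cong r (·-congʳ (≋-sym (dil-ι c)))) (part-dil· r (ι c) f r≤2)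

q³≋ : ∀ f → q · (q · (q · dil f)) ≋ dil (q · f)
q³≋ f = ≋-sym (dil-homo
  (≋-trans (part₀-q _) (·-congˡ (≋-trans (part₂-q _) (≋-trans (part₁-q _) (part₀-dil f)))))
  (≋-trans (part₁-q _) (≋-trans (part₀-q _) (≋-trans (·-congˡ (≋-trans (part₂-q _) (part₁-dil f))) z)))
  (≋-trans (part₂-q _) (≋-trans (part₁-q _) (≋-trans (part₀-q _) (≋-trans (·-congˡ (part₂-dil f)) z)))))
  where
  z : q · ι 0ℤ ≋ ι 0ℤ
  z = solve 1 (λ f → f :* con 0ℤ := con 0ℤ) ≋-refl q

q^3≋dil : q ↑ 3 ≋ dil q
q^3≋dil = begin
  q ↑ 3                          ≈⟨ solve 1 (λ q → q :^ 3 := q :* (q :* (q :* con 1ℤ))) ≋-refl q ⟩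
  q · (q · (q · ι 1ℤ))           ≈⟨ ·-congˡ (·-congˡ (·-congˡ (dil-ι 1ℤ))) ⟨
  q · (q · (q · dil (ι 1ℤ)))     ≈⟨ q³≋ (ι 1ℤ) ⟩
  dil (q · ι 1ℤ)                 ≈⟨ dil-cong (·-identityʳ q) ⟩
  dil q                          ∎
  where open ≋-Reasoning

q^*3 : ∀ n → q ↑ (n * 3) ≋ dil (q ↑ n)
q^*3 n = begin
  q ↑ (n * 3)   ≡⟨ cong (q ↑_) (ℕₚ.*-comm n 3) ⟩
  q ↑ (3 * n)   ≈⟨ ^-assocʳ q 3 n ⟨
  (q ↑ 3) ↑ n     ≈⟨ ^-congˡ n q^3≋dil ⟩
  dil q ↑ n       ≈⟨ dil-^ q n ⟨
  dil (q ↑ n)     ∎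
  where open ≋-Reasoning

parts : ∀ f → f ≋ dil (part 0 f) ⊕ q · dil (part 1 f) ⊕ q · (q · dil (part 2 f))
parts f = parts-ext
  (≋-sym (≋-trans (three 0) (≋-trans (⊕-cong (⊕-cong (part₀-dil _)
      (≋-trans (part₀-q _) (·-congˡ (part₂-dil _))))
      (≋-trans (part₀-q _) (·-congˡ (≋-trans (part₂-q _) (part₁-dil _)))))
    (solve 2 (λ q x → x :+ q :* con 0ℤ :+ q :* con 0ℤ := x) ≋-refl q (part 0 f)))))
  (≋-sym (≋-trans (three 1) (≋-trans (⊕-cong (⊕-cong (part₁-dil _)
      (≋-trans (part₁-q _) (part₀-dil _)))
      (≋-trans (part₁-q _) (≋-trans (part₀-q _) (·-congˡ (part₂-dil _)))))
    (solve 2 (λ q x → con 0ℤ :+ x :+ q :* con 0ℤ := x) ≋-refl q (part 1 f)))))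
  (≋-sym (≋-trans (three 2) (≋-trans (⊕-cong (⊕-cong (part₂-dil _)
      (≋-trans (part₂-q _) (part₁-dil _)))
      (≋-trans (part₂-q _) (≋-trans (part₁-q _) (part₀-dil _))))
    (solve 1 (λ x → con 0ℤ :+ con 0ℤ :+ x := x) ≋-refl (part 2 f)))))
  where
  three : ∀ r → part r (dil (part 0 f) ⊕ q · dil (part 1 f) ⊕ q · (q · dil (part 2 f)))
    ≋ part r (dil (part 0 f)) ⊕ part r (q · dil (part 1 f)) ⊕ part r (q · (q · dil (part 2 f)))
  three r = ≋-trans (part-⊕ r _ _) (⊕-congʳ (part-⊕ r _ _))

part-· : ∀ r f g → r ≤ 2 → part r (f · g)
  ≋ part 0 f · part r g ⊕ part 1 f · part r (q · g) ⊕ part 2 f · part r (q · (q · g))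
part-· r f g r≤2 = begin
  part r (f · g)
    ≈⟨ part-cong r (≋-trans (·-congʳ (parts f))
         (solve 5 (λ q a b c g → (a :+ q :* b :+ q :* (q :* c)) :* g
             := a :* g :+ b :* (q :* g) :+ c :* (q :* (q :* g)))
           ≋-refl q (dil f₀) (dil f₁) (dil f₂) g)) ⟩
  part r (dil f₀ · g ⊕ dil f₁ · (q · g) ⊕ dil f₂ · (q · (q · g)))
    ≈⟨ ≋-trans (part-⊕ r _ _) (⊕-congʳ (part-⊕ r _ _)) ⟩
  part r (dil f₀ · g) ⊕ part r (dil f₁ · (q · g)) ⊕ part r (dil f₂ · (q · (q · g)))
    ≈⟨ ⊕-cong (⊕-cong (part-dil· r f₀ _ r≤2) (part-dil· r f₁ _ r≤2)) (part-dil· r f₂ _ r≤2) ⟩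
  f₀ · part r g ⊕ f₁ · part r (q · g) ⊕ f₂ · part r (q · (q · g)) ∎
  where
  open ≋-Reasoning
  f₀ f₁ f₂ : PS
  f₀ = part 0 f
  f₁ = part 1 f
  f₂ = part 2 f

-- norm f is the series in q³ equal to f(q) f(ωq) f(ω²q) for a primitive cube root of unity ω,
-- with q³ renamed to q.
norm₃ : PS → PS → PS → PS
norm₃ x y z = x ↑ 3 ⊕ q · y ↑ 3 ⊕ q ↑ 2 · z ↑ 3 ⊕ ⊝ (ι (+ 3) · (q · (x · y · z)))

norm₃-cong : ∀ {x x′ y y′ z z′} → x ≋ x′ → y ≋ y′ → z ≋ z′ → norm₃ x y z ≋ norm₃ x′ y′ z′
norm₃-cong a b c = ⊕-cong (⊕-cong (⊕-cong (^-congˡ 3 a) (·-congˡ (^-congˡ 3 b))) (·-congˡ (^-congˡ 3 c)))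
  (⊝-cong (·-congˡ (·-congˡ (·-cong (·-cong a b) c))))

norm : PS → PS
norm f = norm₃ (part 0 f) (part 1 f) (part 2 f)

norm-cong : ∀ {f g} → f ≋ g → norm f ≋ norm g
norm-cong p = norm₃-cong (part-cong 0 p) (part-cong 1 p) (part-cong 2 p)

-- In terms of the residue parts this is the composition law of the cubic form x³ + q y³ + q² z³ -
-- 3qxyz, a polynomial identity.
norm-· : ∀ f g → norm (f · g) ≋ norm f · norm g
norm-· f g = ≋-trans (norm₃-cong
    (≋-trans (part-· 0 f g z≤n) (⊕-cong (⊕-congˡ (·-congˡ (part₀-q g)))
      (·-congˡ (≋-trans (part₀-q _) (·-congˡ (part₂-q g))))))
    (≋-trans (part-· 1 f g (s≤s z≤n)) (⊕-cong (⊕-congˡ (·-congˡ (part₁-q g)))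
      (·-congˡ (≋-trans (part₁-q _) (part₀-q g)))))
    (≋-trans (part-· 2 f g ℕₚ.≤-refl) (⊕-cong (⊕-congˡ (·-congˡ (part₂-q g)))
      (·-congˡ (≋-trans (part₂-q _) (part₁-q g))))))
  (solve 7 (λ q a b c x y z →
     let n : _ → _ → _ → _
         n a b c = a :^ 3 :+ q :* b :^ 3 :+ q :^ 2 :* c :^ 3 :- con (+ 3) :* (q :* (a :* b :* c))
     in  n (a :* x :+ b :* (q :* z) :+ c :* (q :* y)) (a :* y :+ b :* x :+ c :* (q :* z))
           (a :* z :+ b :* y :+ c :* x)
         := n a b c :* n x y z)
    ≋-refl q (part 0 f) (part 1 f) (part 2 f) (part 0 g) (part 1 g) (part 2 g))

-- The coefficients of a part up to index N come from indices up to 3N + 2, so taking parts divides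
-- the precision by three.
part-cong[] : ∀ r {N f g} → r ≤ 2 → f ≋[ 2 + N * 3 ] g → part r f ≋[ N ] part r g
part-cong[] r r≤2 p = upTo λ n n≤N → at≤ p _ (ℕₚ.+-mono-≤ r≤2 (ℕₚ.*-monoˡ-≤ 3 n≤N))

norm-cong[] : ∀ {N f g} → f ≋[ 2 + N * 3 ] g → norm f ≋[ N ] norm g
norm-cong[] {N} {f} {g} p = ⊕-cong[]
    (⊕-cong[] (⊕-cong[] (^-cong[] 3 p₀) (·-cong[] {f = q} []-refl (^-cong[] 3 p₁)))
    (·-cong[] {f = q ↑ 2} []-refl (^-cong[] 3 p₂)))
  (⊝-cong[] (·-cong[] {f = ι (+ 3)} []-refl (·-cong[] {f = q} []-refl (·-cong[] (·-cong[] p₀ p₁) p₂))))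
  where
  p₀ : part 0 f ≋[ N ] part 0 g
  p₀ = part-cong[] 0 z≤n p
  p₁ : part 1 f ≋[ N ] part 1 g
  p₁ = part-cong[] 1 (s≤s z≤n) p
  p₂ : part 2 f ≋[ N ] part 2 g
  p₂ = part-cong[] 2 ℕₚ.≤-refl p

-- The norm of E₁

part-1- : ∀ r f → part r (ι 1ℤ ⊕ ⊝ f) ≋ part r (ι 1ℤ) ⊕ ⊝ part r f
part-1- r f = ≋-trans (part-⊕ r _ _) (⊕-congˡ (part-⊝ r f))

module _ (M : ℕ) where
  private
    y : PS
    y = q ↑ M

    z : q · ι 0ℤ ≋ ι 0ℤ
    z = solve 1 (λ f → f :* con 0ℤ := con 0ℤ) ≋-refl q

    dil-y : q ↑ (M * 3) ≋ dil y
    dil-y = q^*3 M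

    y³ : q ↑ (M * 3) ≋ y ↑ 3
    y³ = ≋-sym (^-assocʳ q M 3)

  -- For k prime to 3 the conjugates of 1 - q^k multiply to 1 - q^(3k), and renaming q³ to q
  -- restores 1 - q^k.
  norm-factor₁ : norm (ι 1ℤ ⊕ ⊝ (q ↑ (1 + M * 3))) ≋ ι 1ℤ ⊕ ⊝ (q ↑ (1 + M * 3))
  norm-factor₁ = begin
    norm (ι 1ℤ ⊕ ⊝ (q · q ↑ (M * 3)))
      ≈⟨ norm-cong (⊕-congˡ (⊝-cong (·-congˡ dil-y))) ⟩
    norm (ι 1ℤ ⊕ ⊝ (q · dil y))
      ≈⟨ norm₃-cong
           (≋-trans (part-1- 0 _) (⊕-cong (part₀-ι 1ℤ)
             (⊝-cong (≋-trans (part₀-q _) (≋-trans (·-congˡ (part₂-dil y)) z)))))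
           (≋-trans (part-1- 1 _) (⊕-cong (part₁-ι 1ℤ) (⊝-cong (≋-trans (part₁-q _) (part₀-dil y)))))
           (≋-trans (part-1- 2 _) (⊕-cong (part₂-ι 1ℤ) (⊝-cong (≋-trans (part₂-q _) (part₁-dil y))))) ⟩
    norm₃ (ι 1ℤ ⊕ ⊝ ι 0ℤ) (ι 0ℤ ⊕ ⊝ y) (ι 0ℤ ⊕ ⊝ ι 0ℤ)
      ≈⟨ solve 2 (λ q y →
           let a = con 1ℤ :- con 0ℤ
               b = con 0ℤ :- y
               c = con 0ℤ :- con 0ℤ
           in a :^ 3 :+ q :* b :^ 3 :+ q :^ 2 :* c :^ 3 :- con (+ 3) :* (q :* (a :* b :* c))
              := con 1ℤ :- q :* y :^ 3) ≋-refl q y ⟩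
    ι 1ℤ ⊕ ⊝ (q · y ↑ 3)
      ≈⟨ ⊕-congˡ (⊝-cong (·-congˡ y³)) ⟨
    ι 1ℤ ⊕ ⊝ (q · q ↑ (M * 3)) ∎
    where open ≋-Reasoning

  norm-factor₂ : norm (ι 1ℤ ⊕ ⊝ (q ↑ (2 + M * 3))) ≋ ι 1ℤ ⊕ ⊝ (q ↑ (2 + M * 3))
  norm-factor₂ = begin
    norm (ι 1ℤ ⊕ ⊝ (q · (q · q ↑ (M * 3))))
      ≈⟨ norm-cong (⊕-congˡ (⊝-cong (·-congˡ (·-congˡ dil-y)))) ⟩
    norm (ι 1ℤ ⊕ ⊝ (q · (q · dil y)))
      ≈⟨ norm₃-cong
           (≋-trans (part-1- 0 _) (⊕-cong (part₀-ι 1ℤ)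
             (⊝-cong (≋-trans (part₀-q _) (≋-trans (·-congˡ (≋-trans (part₂-q _) (part₁-dil y))) z)))))
           (≋-trans (part-1- 1 _) (⊕-cong (part₁-ι 1ℤ)
             (⊝-cong (≋-trans (part₁-q _) (≋-trans (part₀-q _) (≋-trans (·-congˡ (part₂-dil y)) z))))))
           (≋-trans (part-1- 2 _) (⊕-cong (part₂-ι 1ℤ)
             (⊝-cong (≋-trans (part₂-q _) (≋-trans (part₁-q _) (part₀-dil y)))))) ⟩
    norm₃ (ι 1ℤ ⊕ ⊝ ι 0ℤ) (ι 0ℤ ⊕ ⊝ ι 0ℤ) (ι 0ℤ ⊕ ⊝ y)
      ≈⟨ solve 2 (λ q y →
           let a = con 1ℤ :- con 0ℤ
               b = con 0ℤ :- con 0ℤ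
               c = con 0ℤ :- y
           in a :^ 3 :+ q :* b :^ 3 :+ q :^ 2 :* c :^ 3 :- con (+ 3) :* (q :* (a :* b :* c))
              := con 1ℤ :- q :* (q :* y :^ 3)) ≋-refl q y ⟩
    ι 1ℤ ⊕ ⊝ (q · (q · y ↑ 3))
      ≈⟨ ⊕-congˡ (⊝-cong (·-congˡ (·-congˡ y³))) ⟨
    ι 1ℤ ⊕ ⊝ (q · (q · q ↑ (M * 3))) ∎
    where open ≋-Reasoning

  -- A series in q³ equals its conjugates, so its norm is its cube, here with q³ renamed to q.
  norm-factor₃ : norm (ι 1ℤ ⊕ ⊝ (q ↑ (3 + M * 3))) ≋ (ι 1ℤ ⊕ ⊝ (q ↑ suc M)) ↑ 3
  norm-factor₃ = begin
    norm (ι 1ℤ ⊕ ⊝ (q ↑ (suc M * 3)))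
      ≈⟨ norm-cong (⊕-congˡ (⊝-cong (q^*3 (suc M)))) ⟩
    norm (ι 1ℤ ⊕ ⊝ dil (q · y))
      ≈⟨ norm₃-cong
           (≋-trans (part-1- 0 _) (⊕-cong (part₀-ι 1ℤ) (⊝-cong (part₀-dil _))))
           (≋-trans (part-1- 1 _) (⊕-cong (part₁-ι 1ℤ) (⊝-cong (part₁-dil _))))
           (≋-trans (part-1- 2 _) (⊕-cong (part₂-ι 1ℤ) (⊝-cong (part₂-dil _)))) ⟩
    norm₃ (ι 1ℤ ⊕ ⊝ (q · y)) (ι 0ℤ ⊕ ⊝ ι 0ℤ) (ι 0ℤ ⊕ ⊝ ι 0ℤ)
      ≈⟨ solve 2 (λ q y →
           let a = con 1ℤ :- q :* y
               b = con 0ℤ :- con 0ℤ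
           in a :^ 3 :+ q :* b :^ 3 :+ q :^ 2 :* b :^ 3 :- con (+ 3) :* (q :* (a :* b :* b))
              := a :^ 3) ≋-refl q y ⟩
    (ι 1ℤ ⊕ ⊝ (q · y)) ↑ 3 ∎
    where open ≋-Reasoning

-- Factors with index prime to 3 reproduce themselves. The multiples of 3 give the cube, and
-- `prodE 3 M` on the left restores their own factors, which completes `prodE 1 (M * 3)` on the
-- right.
norm-prodE : ∀ M → norm (prodE 1 (M * 3)) · prodE 3 M ≋ prodE 1 (M * 3) · prodE 1 M ↑ 3
norm-prodE zero = begin
  norm oneS · oneS
    ≈⟨ ·-cong (norm-cong oneS≋1) oneS≋1 ⟩
  norm (ι 1ℤ) · ι 1ℤ
    ≈⟨ ·-congʳ (norm₃-cong (part₀-ι 1ℤ) (part₁-ι 1ℤ) (part₂-ι 1ℤ)) ⟩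
  norm₃ (ι 1ℤ) (ι 0ℤ) (ι 0ℤ) · ι 1ℤ
    ≈⟨ solve 1 (λ q → (con 1ℤ :^ 3 :+ q :* con 0ℤ :^ 3 :+ q :^ 2 :* con 0ℤ :^ 3
           :- con (+ 3) :* (q :* (con 1ℤ :* con 0ℤ :* con 0ℤ))) :* con 1ℤ
         := con 1ℤ :* con 1ℤ :^ 3) ≋-refl q ⟩
  ι 1ℤ · ι 1ℤ ↑ 3
    ≈⟨ ·-cong oneS≋1 (^-congˡ 3 oneS≋1) ⟨
  oneS · oneS ↑ 3 ∎
  where open ≋-Reasoning
norm-prodE (suc M) = begin
  norm (prodE 1 (3 + n)) · prodE 3 (suc M)
    ≈⟨ ·-cong (norm-cong P₃) (≋-trans (prodE-suc 2 M) (·-congˡ (⊕-congˡ (⊝-cong e)))) ⟩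
  norm (P · f₁ · f₂ · f₃) · (prodE 3 M · f₃)
    ≈⟨ ·-congʳ (≋-trans (norm-· (P · f₁ · f₂) f₃) (·-cong (≋-trans (norm-· (P · f₁) f₂)
         (·-cong (≋-trans (norm-· P f₁) (·-congˡ (norm-factor₁ M))) (norm-factor₂ M))) (norm-factor₃ M))) ⟩
  norm P · f₁ · f₂ · d ↑ 3 · (prodE 3 M · f₃)
    ≈⟨ solve 6 (λ n f₁ f₂ f₃ d p → n :* f₁ :* f₂ :* d :^ 3 :* (p :* f₃)
           := n :* p :* (f₁ :* f₂ :* f₃ :* d :^ 3))
         ≋-refl (norm P) f₁ f₂ f₃ d (prodE 3 M) ⟩
  norm P · prodE 3 M · (f₁ · f₂ · f₃ · d ↑ 3)
    ≈⟨ ·-congʳ (norm-prodE M) ⟩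
  P · prodE 1 M ↑ 3 · (f₁ · f₂ · f₃ · d ↑ 3)
    ≈⟨ solve 6 (λ n f₁ f₂ f₃ d p → n :* p :^ 3 :* (f₁ :* f₂ :* f₃ :* d :^ 3)
           := n :* f₁ :* f₂ :* f₃ :* (p :* d) :^ 3)
         ≋-refl P f₁ f₂ f₃ d (prodE 1 M) ⟩
  P · f₁ · f₂ · f₃ · (prodE 1 M · d) ↑ 3
    ≈⟨ ·-cong P₃ (^-congˡ 3 (prodE₁-suc M)) ⟨
  prodE 1 (3 + n) · prodE 1 (suc M) ↑ 3 ∎
  where
  open ≋-Reasoning
  n : ℕ
  n = M * 3
  P f₁ f₂ f₃ d : PS
  P = prodE 1 n
  f₁ = ι 1ℤ ⊕ ⊝ (q ↑ (1 + n))
  f₂ = ι 1ℤ ⊕ ⊝ (q ↑ (2 + n))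
  f₃ = ι 1ℤ ⊕ ⊝ (q ↑ (3 + n))
  d = ι 1ℤ ⊕ ⊝ (q ↑ suc M)
  P₃ : prodE 1 (3 + n) ≋ P · f₁ · f₂ · f₃
  P₃ = ≋-trans (prodE₁-suc (2 + n)) (·-congʳ (≋-trans (prodE₁-suc (1 + n)) (·-congʳ (prodE₁-suc n))))
  e : q ↑ (3 * suc M) ≋ q ↑ (3 + n)
  e = ≋-reflexive (cong (q ↑_) (ℕₚ.*-comm 3 (suc M)))

norm-E : norm (E 1) · E 3 ≋ E 1 · E 1 ↑ 3
-- The product is cut at M = N + 1: order N of the norm asks for precision 3N + 2 in E₁, and 3M = 3N
-- + 3 suffices.
norm-E = all-≋[] λ N → let n≤ = ℕₚ.n≤1+n (2 + N * 3); N≤M = ℕₚ.n≤1+n N in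
  []-trans (·-cong[] ([]-sym (norm-cong[] (prodE≋[]E 0 n≤))) ([]-sym (prodE≋[]E 2 N≤M)))
    ([]-trans (≋⇒≋[] (norm-prodE (suc N)))
      (·-cong[] (prodE≋[]E 0 (ℕₚ.≤-trans N≤M (ℕₚ.m≤m*n (suc N) 3))) (^-cong[] 3 (prodE≋[]E 0 N≤M))))

-- The residue parts of E₁³

E₃≋dil : E 3 ≋ dil (E 1)
E₃≋dil = pointwise λ n → trans (at (go n) n) (dil-cong≤ n λ k k≤n → prodE-stable 0 k≤n)
  where
  open ≋-Reasoning
  go : ∀ N → prodE 3 N ≋ dil (prodE 1 N)
  go zero    = ≋-trans oneS≋1 (≋-trans (≋-sym (dil-ι 1ℤ)) (dil-cong (≋-sym oneS≋1)))
  go (suc N) = begin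
    prodE 3 (suc N)
      ≈⟨ prodE-suc 2 N ⟩
    prodE 3 N · (ι 1ℤ ⊕ ⊝ (q ↑ (3 * suc N)))
      ≈⟨ ·-cong (go N) (⊕-cong (≋-sym (dil-ι 1ℤ)) (⊝-cong
           (≋-trans (≋-reflexive (cong (q ↑_) (ℕₚ.*-comm 3 (suc N)))) (q^*3 (suc N))))) ⟩
    dil (prodE 1 N) · (dil (ι 1ℤ) ⊕ ⊝ dil (q ↑ suc N))
      ≈⟨ ·-congˡ (≋-trans (⊕-congˡ (≋-sym (dil-⊝ _))) (≋-sym (dil-⊕ _ _))) ⟩
    dil (prodE 1 N) · dil (ι 1ℤ ⊕ ⊝ (q ↑ suc N))
      ≈⟨ dil-· _ _ ⟨
    dil (prodE 1 N · (ι 1ℤ ⊕ ⊝ (q ↑ suc N)))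
      ≈⟨ dil-cong (prodE₁-suc N) ⟨
    dil (prodE 1 (suc N)) ∎

-- 3j(3j+1)/2 + 3j = 9 j(j+1)/2. The extra factor q^(3j) makes the exponent nine times the one of
-- `theta j`, and also turns `theta (j * 3)` into `theta (1 + j * 3)` up to a factor -q.
theta-*3 : ∀ j → q ↑ (j * 3) · theta (j * 3) ≋ dil (dil (theta j))
theta-*3 zero    = ≋-trans (·-identityʳ _) (≋-trans (≋-sym (dil-ι 1ℤ)) (dil-cong (≋-sym (dil-ι 1ℤ))))
theta-*3 (suc j) = begin
  Q · ⊝ (Q · ⊝ (q · (q · y) · ⊝ (q · y · s)))
    ≈⟨ solve 4 (λ q Q y s → Q :* (:- (Q :* :- (q :* (q :* y) :* :- (q :* y :* s))))
         := :- (Q :* Q :* (q :* (q :* (q :* y))) :* (y :* s))) ≋-refl q Q y s ⟩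
  ⊝ (Q · Q · Q · (y · s))
    ≈⟨ ⊝-cong (·-cong (solve 1 (λ Q → Q :* Q :* Q := Q :^ 3) ≋-refl Q) (theta-*3 j)) ⟩
  ⊝ (Q ↑ 3 · dil (dil (theta j)))
    ≈⟨ ⊝-cong (·-congʳ (≋-trans (^-assocʳ q (suc j * 3) 3)
         (≋-trans (q^*3 (suc j * 3)) (dil-cong (q^*3 (suc j)))))) ⟩
  ⊝ (dil (dil (q ↑ suc j)) · dil (dil (theta j)))
    ≈⟨ ⊝-cong (≋-trans (dil-cong (dil-· _ _)) (dil-· _ _)) ⟨
  ⊝ dil (dil (q ↑ suc j · theta j))
    ≈⟨ ≋-trans (dil-cong (dil-⊝ _)) (dil-⊝ _) ⟨
  dil (dil (⊝ (q ↑ suc j · theta j))) ∎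
  where
  open ≋-Reasoning
  Q y s : PS
  Q = q ↑ (suc j * 3)
  y = q ↑ (j * 3)
  s = theta (j * 3)

theta-1+*3 : ∀ j → theta (1 + j * 3) ≋ ⊝ (q · dil (dil (theta j)))
theta-1+*3 j = ⊝-cong (≋-trans (·-assoc q _ _) (·-congˡ (theta-*3 j)))

theta-2+*3 : ∀ j → theta (2 + j * 3) ≋ dil (q ↑ suc j · dil (theta j))
theta-2+*3 j = begin
  ⊝ (q · (q · y) · ⊝ (q · y · s))
    ≈⟨ solve 3 (λ q y s → :- (q :* (q :* y) :* :- (q :* y :* s))
         := q :* (q :* (q :* y)) :* (y :* s)) ≋-refl q y s ⟩
  q ↑ (suc j * 3) · (y · s)
    ≈⟨ ·-cong (q^*3 (suc j)) (theta-*3 j) ⟩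
  dil (q ↑ suc j) · dil (dil (theta j))
    ≈⟨ dil-· _ _ ⟨
  dil (q ↑ suc j · dil (theta j)) ∎
  where
  open ≋-Reasoning
  y s : PS
  y = q ↑ (j * 3)
  s = theta (j * 3)

-- Records only that the exponent is divisible by 3; the preimage under `dil` is named as the part
-- itself.
theta-*3-dil : ∀ j → theta (j * 3) ≋ dil (part 0 (theta (j * 3)))
theta-*3-dil zero    = ≋-trans (≋-sym (dil-ι 1ℤ)) (dil-cong (≋-sym (part₀-ι 1ℤ)))
theta-*3-dil (suc j) = ≋-trans isDil (dil-cong (≋-sym (≋-trans (part-cong 0 isDil) (part₀-dil _))))
  where
  isDil : theta (suc j * 3) ≋ dil (⊝ (q ↑ suc j · (q ↑ suc j · dil (theta j))))
  isDil = ≋-trans (⊝-cong (≋-trans (·-cong (q^*3 (suc j)) (theta-2+*3 j)) (≋-sym (dil-· _ _))))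
    (≋-sym (dil-⊝ _))

-- The source of the 3 in A - 3B: 2(3j+1) + 1 = 3(2j+1).
odd-1+*3 : ∀ j → odd (1 + j * 3) ≡ + 3 ℤ.* odd j
odd-1+*3 zero    = refl
odd-1+*3 (suc j) = trans (cong (λ z → + 2 ℤ.+ (+ 2 ℤ.+ (+ 2 ℤ.+ z))) (odd-1+*3 j))
  (S.solve 1 (λ x → S.con (+ 2) S.:+ (S.con (+ 2) S.:+ (S.con (+ 2) S.:+ S.con (+ 3) S.:* x))
    S.:= S.con (+ 3) S.:* (S.con (+ 2) S.:+ x)) refl (odd j))
  where module S = +-*-Solver

jacobiTerm : ℕ → PS
jacobiTerm k = ι (odd k) · theta k

part-dil·ι : ∀ r c {f g h} → r ≤ 2 → f ≋ g → part r g ≋ h → part r (ι c · f) ≋ ι c · h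
part-dil·ι r c {f} r≤2 p s = ≋-trans (part-ι· r c f r≤2) (·-congˡ (≋-trans (part-cong r p) s))

-- k(k+1)/2 is 0, 1, 0 modulo 3 for k = 0, 1, 2 modulo 3, so in each triple only the middle term
-- reaches residue 1, and none reaches residue 2.
part₁-triple : ∀ j → part 1 (jacobiTerm (j * 3)) ⊕ part 1 (jacobiTerm (1 + j * 3))
    ⊕ part 1 (jacobiTerm (2 + j * 3)) ≋ ⊝ (ι (+ 3) · dil (jacobiTerm j))
part₁-triple j = begin
  _ ≈⟨ ⊕-cong (⊕-cong
         (part-dil·ι 1 _ 1≤2 (theta-*3-dil j) (part₁-dil _))
         (≋-trans (part-dil·ι 1 _ 1≤2 (theta-1+*3 j)
             (≋-trans (part-⊝ 1 _) (⊝-cong (≋-trans (part₁-q _) (part₀-dil _)))))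
           (·-congʳ (≋-trans (≋-reflexive (cong ι (odd-1+*3 j))) (ι-* (+ 3) (odd j))))))
         (part-dil·ι 1 _ 1≤2 (theta-2+*3 j) (part₁-dil _)) ⟩
  c₀ · ι 0ℤ ⊕ ι (+ 3) · ι (odd j) · (⊝ dil (theta j)) ⊕ c₂ · ι 0ℤ
    ≈⟨ solve 4 (λ c₀ c₂ w d → c₀ :* con 0ℤ :+ con (+ 3) :* w :* (:- d) :+ c₂ :* con 0ℤ
         := :- (con (+ 3) :* (w :* d))) ≋-refl c₀ c₂ (ι (odd j)) (dil (theta j)) ⟩
  ⊝ (ι (+ 3) · (ι (odd j) · dil (theta j)))
    ≈⟨ ⊝-cong (·-congˡ (≋-trans (dil-· _ _) (·-congʳ (dil-ι (odd j))))) ⟨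
  ⊝ (ι (+ 3) · dil (jacobiTerm j)) ∎
  where
  open ≋-Reasoning
  1≤2 : 1 ≤ 2
  1≤2 = s≤s z≤n
  c₀ c₂ : PS
  c₀ = ι (odd (j * 3))
  c₂ = ι (odd (2 + j * 3))

part₂-triple : ∀ j → part 2 (jacobiTerm (j * 3)) ⊕ part 2 (jacobiTerm (1 + j * 3))
    ⊕ part 2 (jacobiTerm (2 + j * 3)) ≋ ι 0ℤ
part₂-triple j = ≋-trans (⊕-cong (⊕-cong
    (part-dil·ι 2 _ ℕₚ.≤-refl (theta-*3-dil j) (part₂-dil _))
    (part-dil·ι 2 _ ℕₚ.≤-refl (theta-1+*3 j)
      (≋-trans (part-⊝ 2 _) (⊝-cong (≋-trans (part₂-q _) (part₁-dil _))))))
    (part-dil·ι 2 _ ℕₚ.≤-refl (theta-2+*3 j) (part₂-dil _)))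
  (solve 3 (λ c₀ c₂ c → c₀ :* con 0ℤ :+ c₂ :* (:- con 0ℤ) :+ c :* con 0ℤ := con 0ℤ) ≋-refl
    (ι (odd (j * 3))) (ι (odd (1 + j * 3))) (ι (odd (2 + j * 3))))

part-⊕₃ : ∀ r a b c → part r (a ⊕ b ⊕ c) ≋ part r a ⊕ part r b ⊕ part r c
part-⊕₃ r a b c = ≋-trans (part-⊕ r _ _) (⊕-congʳ (part-⊕ r a b))

-- Cutting at 3M + 2 keeps the triples complete and is the precision that `part-cong[]` asks for at
-- order M.
part₁-jacobiSum : ∀ M → part 1 (jacobiSum (2 + M * 3)) ≋ ⊝ (ι (+ 3) · dil (jacobiSum M))
part₁-jacobiSum zero    = ≋-trans (part-⊕₃ 1 _ _ _) (part₁-triple 0)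
part₁-jacobiSum (suc M) = begin
  part 1 (S ⊕ x₀ ⊕ x₁ ⊕ x₂)
    ≈⟨ ≋-trans (part-⊕ 1 _ _) (⊕-congʳ (part-⊕₃ 1 _ _ _)) ⟩
  part 1 S ⊕ part 1 x₀ ⊕ part 1 x₁ ⊕ part 1 x₂
    ≈⟨ solve 4 (λ s x₀ x₁ x₂ → s :+ x₀ :+ x₁ :+ x₂ := s :+ (x₀ :+ x₁ :+ x₂)) ≋-refl _ _ _ _ ⟩
  part 1 S ⊕ (part 1 x₀ ⊕ part 1 x₁ ⊕ part 1 x₂)
    ≈⟨ ⊕-cong (part₁-jacobiSum M) (part₁-triple (suc M)) ⟩
  ⊝ (ι (+ 3) · dil (jacobiSum M)) ⊕ ⊝ (ι (+ 3) · dil (jacobiTerm (suc M)))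
    ≈⟨ solve 2 (λ x y → :- (con (+ 3) :* x) :+ :- (con (+ 3) :* y) := :- (con (+ 3) :* (x :+ y)))
         ≋-refl _ _ ⟩
  ⊝ (ι (+ 3) · (dil (jacobiSum M) ⊕ dil (jacobiTerm (suc M))))
    ≈⟨ ⊝-cong (·-congˡ (dil-⊕ _ _)) ⟨
  ⊝ (ι (+ 3) · dil (jacobiSum (suc M))) ∎
  where
  open ≋-Reasoning
  S x₀ x₁ x₂ : PS
  S = jacobiSum (2 + M * 3)
  x₀ = jacobiTerm (suc M * 3)
  x₁ = jacobiTerm (1 + suc M * 3)
  x₂ = jacobiTerm (2 + suc M * 3)

part₂-jacobiSum : ∀ M → part 2 (jacobiSum (2 + M * 3)) ≋ ι 0ℤ
part₂-jacobiSum zero    = ≋-trans (part-⊕₃ 2 _ _ _) (part₂-triple 0)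
part₂-jacobiSum (suc M) = begin
  part 2 (S ⊕ x₀ ⊕ x₁ ⊕ x₂)
    ≈⟨ ≋-trans (part-⊕ 2 _ _) (⊕-congʳ (part-⊕₃ 2 _ _ _)) ⟩
  part 2 S ⊕ part 2 x₀ ⊕ part 2 x₁ ⊕ part 2 x₂
    ≈⟨ solve 4 (λ s x₀ x₁ x₂ → s :+ x₀ :+ x₁ :+ x₂ := s :+ (x₀ :+ x₁ :+ x₂)) ≋-refl _ _ _ _ ⟩
  part 2 S ⊕ (part 2 x₀ ⊕ part 2 x₁ ⊕ part 2 x₂)
    ≈⟨ ⊕-cong (part₂-jacobiSum M) (part₂-triple (suc M)) ⟩
  ι 0ℤ ⊕ ι 0ℤ
    ≈⟨ solve 0 (con 0ℤ :+ con 0ℤ := con 0ℤ) ≋-refl ⟩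
  ι 0ℤ ∎
  where
  open ≋-Reasoning
  S x₀ x₁ x₂ : PS
  S = jacobiSum (2 + M * 3)
  x₀ = jacobiTerm (suc M * 3)
  x₁ = jacobiTerm (1 + suc M * 3)
  x₂ = jacobiTerm (2 + suc M * 3)

-- The part of residue 1 is again Jacobi's sum, in q³ and with factor -3, so Jacobi's identity
-- applies a second time.
part₁-E³ : part 1 (E 1 ↑ 3) ≋ ⊝ (ι (+ 3) · E 3 ↑ 3)
part₁-E³ = ≋-trans
  (all-≋[] λ N → []-trans ([]-sym (part-cong[] 1 (s≤s z≤n) (jacobi≤ (2 + N * 3))))
    ([]-trans (≋⇒≋[] (part₁-jacobiSum N))
      (⊝-cong[] (·-cong[] {f = ι (+ 3)} []-refl (dil-cong[] (jacobi≤ N))))))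
  (⊝-cong (·-congˡ (≋-trans (dil-^ (E 1) 3) (^-congˡ 3 (≋-sym E₃≋dil)))))

part₂-E³ : part 2 (E 1 ↑ 3) ≋ ι 0ℤ
part₂-E³ = all-≋[] λ N → []-trans ([]-sym (part-cong[] 2 ℕₚ.≤-refl (jacobi≤ (2 + N * 3))))
  (≋⇒≋[] (part₂-jacobiSum N))

-- The matrix m

-- 1/E₃, given as a series in q³ so that it passes through the dissection.
u : PS
u = dil v

E₃·u : E 3 · u ≋ ι 1ℤ
E₃·u = ≋-trans (·-congʳ E₃≋dil) (≋-trans (≋-sym (dil-· (E 1) v)) (≋-trans (dil-cong E·v) (dil-ι 1ℤ)))

dilE₃·dilu : dil (E 3) · dil u ≋ ι 1ℤ
dilE₃·dilu = ≋-trans (≋-sym (dil-· (E 3) u)) (≋-trans (dil-cong E₃·u) (dil-ι 1ℤ))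

1^ : ∀ n → ι 1ℤ ↑ n ≋ ι 1ℤ
1^ zero    = ≋-refl
1^ (suc n) = ≋-trans (·-identityˡ _) (1^ n)

^-inverse : ∀ {f g} n → f · g ≋ ι 1ℤ → f ↑ n · g ↑ n ≋ ι 1ℤ
^-inverse {f} {g} n p = ≋-trans (≋-sym (^-distrib-* f g n)) (≋-trans (^-congˡ n p) (1^ n))

-- α and -3β are the parts of E₁³ of residue 0 and 1, and φ = E₃³/E₁¹² is the inverse of its norm.
-- `A`, `b`, `Φ` are these series in q³, and B carries the extra q. All information about α enters
-- through the norm.
α β φ A B b Φ : PS
α = part 0 (E 1 ↑ 3)
β = E 3 ↑ 3
φ = E 3 ↑ 3 · v ↑ 12
A = dil α
b = dil β
B = q · b
Φ = dil φ

E³≋ : E 1 ↑ 3 ≋ A ⊕ ⊝ (ι (+ 3) · B)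
E³≋ = begin
  E 1 ↑ 3
    ≈⟨ parts (E 1 ↑ 3) ⟩
  A ⊕ q · dil (part 1 (E 1 ↑ 3)) ⊕ q · (q · dil (part 2 (E 1 ↑ 3)))
    ≈⟨ ⊕-cong (⊕-congˡ (·-congˡ (≋-trans (dil-cong part₁-E³) (≋-trans (dil-⊝ _) (⊝-cong
         (≋-trans (dil-· _ _) (·-congʳ (dil-ι (+ 3)))))))))
         (·-congˡ (·-congˡ (≋-trans (dil-cong part₂-E³) (dil-ι 0ℤ)))) ⟩
  A ⊕ q · (⊝ (ι (+ 3) · b)) ⊕ q · (q · ι 0ℤ)
    ≈⟨ solve 3 (λ q x b → x :+ q :* (:- (con (+ 3) :* b)) :+ q :* (q :* con 0ℤ)
         := x :- con (+ 3) :* (q :* b)) ≋-refl q A b ⟩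
  A ⊕ ⊝ (ι (+ 3) · B) ∎
  where open ≋-Reasoning

norm-E³ : norm (E 1 ↑ 3) ≋ α ↑ 3 ⊕ ⊝ (ι (+ 27) · (q · β ↑ 3))
norm-E³ = ≋-trans (norm₃-cong ≋-refl part₁-E³ part₂-E³)
  (solve 3 (λ q x y →
     let y′ = :- (con (+ 3) :* y)
         z = con 0ℤ
     in x :^ 3 :+ q :* y′ :^ 3 :+ q :^ 2 :* z :^ 3 :- con (+ 3) :* (q :* (x :* y′ :* z))
        := x :^ 3 :- con (+ 27) :* (q :* y :^ 3)) ≋-refl q α β)

norm-E³·φ : (α ↑ 3 ⊕ ⊝ (ι (+ 27) · (q · β ↑ 3))) · φ ≋ ι 1ℤ
norm-E³·φ = begin
  (α ↑ 3 ⊕ ⊝ (ι (+ 27) · (q · β ↑ 3))) · φ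
    ≈⟨ ·-congʳ norm-E³ ⟨
  norm (E 1 ↑ 3) · φ
    ≈⟨ ·-congʳ (norm-cong (solve 1 (λ e → e :^ 3 := e :* e :* e) ≋-refl (E 1))) ⟩
  norm (E 1 · E 1 · E 1) · φ
    ≈⟨ ·-congʳ (≋-trans (norm-· _ _) (·-congʳ (norm-· _ _))) ⟩
  norm (E 1) · norm (E 1) · norm (E 1) · φ
    ≈⟨ solve 3 (λ n e v → n :* n :* n :* (e :^ 3 :* v :^ 12) := (n :* e) :^ 3 :* v :^ 12)
         ≋-refl (norm (E 1)) (E 3) v ⟩
  (norm (E 1) · E 3) ↑ 3 · v ↑ 12
    ≈⟨ ·-congʳ (^-congˡ 3 norm-E) ⟩
  (E 1 · E 1 ↑ 3) ↑ 3 · v ↑ 12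
    ≈⟨ solve 2 (λ e v → (e :* e :^ 3) :^ 3 :* v :^ 12 := e :^ 12 :* v :^ 12) ≋-refl (E 1) v ⟩
  E 1 ↑ 12 · v ↑ 12
    ≈⟨ ^-inverse 12 E·v ⟩
  ι 1ℤ ∎
  where open ≋-Reasoning

-- Expressions are first put into this shape, with zero exponents written out, so that one rule
-- carries `dil` through all of them.
dil-monomial : ∀ i j k l →
  dil (q ↑ i · β ↑ j · α ↑ k · φ ↑ l) ≋ (q ↑ 3) ↑ i · b ↑ j · A ↑ k · Φ ↑ l
dil-monomial i j k l = ≋-trans (dil-· _ _) (·-cong (≋-trans (dil-· _ _) (·-cong (≋-trans (dil-· _ _)
  (·-cong (≋-trans (dil-^ q i) (^-congˡ i (≋-sym q^3≋dil))) (dil-^ β j))) (dil-^ α k))) (dil-^ φ l))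

[A³-27B³]Φ : (A ↑ 3 ⊕ ⊝ (ι (+ 27) · B ↑ 3)) · Φ ≋ ι 1ℤ
[A³-27B³]Φ = begin
  (A ↑ 3 ⊕ ⊝ (ι (+ 27) · B ↑ 3)) · Φ
    ≈⟨ solve 4 (λ q b x y → (x :^ 3 :- con (+ 27) :* (q :* b) :^ 3) :* y
         := (x :^ 3 :- con (+ 27) :* ((q :^ 3) :^ 1 :* b :^ 3 :* x :^ 0 :* y :^ 0)) :* y)
         ≋-refl q b A Φ ⟩
  (A ↑ 3 ⊕ ⊝ (ι (+ 27) · ((q ↑ 3) ↑ 1 · b ↑ 3 · A ↑ 0 · Φ ↑ 0))) · Φ
    ≈⟨ ·-congʳ (⊕-cong (dil-^ α 3) (⊝-cong (·-cong (dil-ι (+ 27)) (dil-monomial 1 3 0 0)))) ⟨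
  (dil (α ↑ 3) ⊕ ⊝ (dil (ι (+ 27)) · dil (q ↑ 1 · β ↑ 3 · α ↑ 0 · φ ↑ 0))) · Φ
    ≈⟨ ·-congʳ (≋-trans (dil-⊕ _ _) (⊕-congˡ (≋-trans (dil-⊝ _) (⊝-cong (dil-· _ _))))) ⟨
  dil (α ↑ 3 ⊕ ⊝ (ι (+ 27) · (q ↑ 1 · β ↑ 3 · α ↑ 0 · φ ↑ 0))) · Φ
    ≈⟨ dil-· _ _ ⟨
  dil ((α ↑ 3 ⊕ ⊝ (ι (+ 27) · (q ↑ 1 · β ↑ 3 · α ↑ 0 · φ ↑ 0))) · φ)
    ≈⟨ dil-cong (solve 4 (λ q b x y →
         (x :^ 3 :- con (+ 27) :* (q :^ 1 :* b :^ 3 :* x :^ 0 :* y :^ 0)) :* y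
         := (x :^ 3 :- con (+ 27) :* (q :* b :^ 3)) :* y) ≋-refl q β α φ) ⟩
  dil ((α ↑ 3 ⊕ ⊝ (ι (+ 27) · (q · β ↑ 3))) · φ)
    ≈⟨ ≋-trans (dil-cong norm-E³·φ) (dil-ι 1ℤ) ⟩
  ι 1ℤ ∎
  where open ≋-Reasoning

-- In the notation of the classical proof, x = 1/ζ with ζ = E₁³/(q E₉³), and dil t = 1/T
-- with T = E₃¹²/(q³ E₉¹²).
x t : PS
x = q · (dil (E 3) ↑ 3 · v ↑ 3)
t = q · (E 3 ↑ 12 · v ↑ 12)

dil-t : dil t ≋ B ↑ 3 · Φ
dil-t = begin
  dil t
    ≈⟨ dil-cong (solve 3 (λ q e v → q :* (e :^ 12 :* v :^ 12)
         := q :^ 1 :* (e :^ 3) :^ 3 :* con 1ℤ :* (e :^ 3 :* v :^ 12) :^ 1) ≋-refl q (E 3) v) ⟩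
  dil (q ↑ 1 · β ↑ 3 · α ↑ 0 · φ ↑ 1)
    ≈⟨ dil-monomial 1 3 0 1 ⟩
  (q ↑ 3) ↑ 1 · b ↑ 3 · A ↑ 0 · Φ ↑ 1
    ≈⟨ solve 4 (λ q b x y → (q :^ 3) :^ 1 :* b :^ 3 :* x :^ 0 :* y :^ 1 := (q :* b) :^ 3 :* y)
         ≋-refl q b A Φ ⟩
  B ↑ 3 · Φ ∎
  where open ≋-Reasoning

-- Rationalising 1/(A - 3B): the cofactor A² + 3AB + 9B² turns the denominator into A³ - 27B³, whose
-- inverse is Φ.
v³≋ : v ↑ 3 ≋ (A ↑ 2 ⊕ ι (+ 3) · A · B ⊕ ι (+ 9) · B ↑ 2) · Φ
v³≋ = inverse-unique (^-inverse 3 E·v) (begin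
  E 1 ↑ 3 · ((A ↑ 2 ⊕ ι (+ 3) · A · B ⊕ ι (+ 9) · B ↑ 2) · Φ)
    ≈⟨ ·-congʳ E³≋ ⟩
  (A ⊕ ⊝ (ι (+ 3) · B)) · ((A ↑ 2 ⊕ ι (+ 3) · A · B ⊕ ι (+ 9) · B ↑ 2) · Φ)
    ≈⟨ solve 3 (λ x y z →
         (x :- con (+ 3) :* y) :* ((x :^ 2 :+ con (+ 3) :* x :* y :+ con (+ 9) :* y :^ 2) :* z)
         := (x :^ 3 :- con (+ 27) :* y :^ 3) :* z) ≋-refl A B Φ ⟩
  (A ↑ 3 ⊕ ⊝ (ι (+ 27) · B ↑ 3)) · Φ
    ≈⟨ [A³-27B³]Φ ⟩
  ι 1ℤ ∎)
  where open ≋-Reasoning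

x≋ : x ≋ B · ((A ↑ 2 ⊕ ι (+ 3) · A · B ⊕ ι (+ 9) · B ↑ 2) · Φ)
x≋ = ≋-trans (·-congˡ (·-cong (≋-sym (dil-^ (E 3) 3)) v³≋)) (≋-sym (·-assoc q b _))

x-cubic : x ↑ 3 ≋ dil t · (ι 1ℤ ⊕ ι (+ 9) · x ⊕ ι (+ 27) · x ↑ 2)
x-cubic = begin
  x ↑ 3
    ≈⟨ ^-congˡ 3 x≋ ⟩
  (B · (S · Φ)) ↑ 3
    -- The factor `one` equals 1, but only by the norm relation. It is inserted so that both sides
    -- agree as polynomials in A, B and Φ.
    ≈⟨ solve 3 (λ x y z →
         let s = x :^ 2 :+ con (+ 3) :* x :* y :+ con (+ 9) :* y :^ 2
             one = (x :^ 3 :- con (+ 27) :* y :^ 3) :* z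
             w = y :* (s :* z)
         in w :^ 3 := y :^ 3 :* z :* (one :^ 2 :+ con (+ 9) :* w :* one :+ con (+ 27) :* w :^ 2))
         ≋-refl A B Φ ⟩
  B ↑ 3 · Φ · (one ↑ 2 ⊕ ι (+ 9) · (B · (S · Φ)) · one ⊕ ι (+ 27) · (B · (S · Φ)) ↑ 2)
    ≈⟨ ·-cong dil-t (⊕-cong (⊕-cong (≋-trans (≋-sym (1^ 2)) (^-congˡ 2 (≋-sym [A³-27B³]Φ)))
         (≋-trans (≋-sym (·-identityʳ _)) (·-cong (·-congˡ x≋) (≋-sym [A³-27B³]Φ))))
         (·-congˡ (^-congˡ 2 x≋))) ⟨
  dil t · (ι 1ℤ ⊕ ι (+ 9) · x ⊕ ι (+ 27) · x ↑ 2) ∎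
  where
  open ≋-Reasoning
  S one : PS
  S = A ↑ 2 ⊕ ι (+ 3) · A · B ⊕ ι (+ 9) · B ↑ 2
  one = (A ↑ 3 ⊕ ⊝ (ι (+ 27) · B ↑ 3)) · Φ

part₀-dissected : ∀ {f f₀} f₁ f₂ → f ≋ dil f₀ ⊕ dil f₁ · q ⊕ dil f₂ · (q · q) → part 0 f ≋ f₀
part₀-dissected {f} {f₀} f₁ f₂ p = begin
  part 0 f
    ≈⟨ part-cong 0 (≋-trans p (solve 4 (λ q x y z → x :+ y :* q :+ z :* (q :* q)
         := x :+ q :* y :+ q :* (q :* z)) ≋-refl q (dil f₀) (dil f₁) (dil f₂))) ⟩
  part 0 (dil f₀ ⊕ q · dil f₁ ⊕ q · (q · dil f₂))
    ≈⟨ part-⊕₃ 0 _ _ _ ⟩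
  part 0 (dil f₀) ⊕ part 0 (q · dil f₁) ⊕ part 0 (q · (q · dil f₂))
    ≈⟨ ⊕-cong (⊕-cong (part₀-dil f₀) (≋-trans (part₀-q _) (·-congˡ (part₂-dil f₁))))
         (≋-trans (part₀-q _) (·-congˡ (≋-trans (part₂-q _) (part₁-dil f₂)))) ⟩
  f₀ ⊕ q · ι 0ℤ ⊕ q · ι 0ℤ
    ≈⟨ solve 2 (λ q x → x :+ q :* con 0ℤ :+ q :* con 0ℤ := x) ≋-refl q f₀ ⟩
  f₀ ∎
  where open ≋-Reasoning

dil-ι· : ∀ c {f g} → dil f ≋ g → dil (ι c · f) ≋ ι c · g
dil-ι· c p = ≋-trans (dil-· _ _) (·-cong (dil-ι c) p)

-- A and Φ are series in q³ and B is q times one, so the residue of a monomial is its degree in B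
-- modulo 3. In B(A² + 3AB + 9B²)Φ only 9B³Φ has residue 0.
part₀-x : part 0 x ≋ ι (+ 9) · t
part₀-x = part₀-dissected (q ↑ 0 · β ↑ 1 · α ↑ 2 · φ ↑ 1) (ι (+ 3) · (q ↑ 0 · β ↑ 2 · α ↑ 1 · φ ↑ 1))
  (≋-trans x≋ (≋-trans
    (solve 4 (λ q b x z → let y = q :* b in
         y :* ((x :^ 2 :+ con (+ 3) :* x :* y :+ con (+ 9) :* y :^ 2) :* z)
         := con (+ 9) :* (y :^ 3 :* z) :+ (q :^ 3) :^ 0 :* b :^ 1 :* x :^ 2 :* z :^ 1 :* q
            :+ con (+ 3) :* ((q :^ 3) :^ 0 :* b :^ 2 :* x :^ 1 :* z :^ 1) :* (q :* q))
      ≋-refl q b A Φ)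
    (≋-sym (⊕-cong (⊕-cong (dil-ι· (+ 9) dil-t) (·-congʳ (dil-monomial 0 1 2 1)))
      (·-congʳ (dil-ι· (+ 3) (dil-monomial 0 2 1 1)))))))

-- The terms of residue 0 in the square are 6A³B³Φ² and 81B⁶Φ². Substituting A³Φ = 1 + 27B³Φ gives 6
-- and 81 + 6·27 = 243.
part₀-x² : part 0 (x ↑ 2) ≋ ι (+ 6) · t ⊕ ι (+ 243) · t ↑ 2
part₀-x² = part₀-dissected (ι (+ 27) · (q ↑ 1 · β ↑ 4 · α ↑ 2 · φ ↑ 2))
  (ι 1ℤ · (q ↑ 0 · β ↑ 2 · α ↑ 4 · φ ↑ 2) ⊕ ι (+ 54) · (q ↑ 1 · β ↑ 5 · α ↑ 1 · φ ↑ 2))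
  (begin
    x ↑ 2
      ≈⟨ ^-congˡ 2 x≋ ⟩
    (B · ((A ↑ 2 ⊕ ι (+ 3) · A · B ⊕ ι (+ 9) · B ↑ 2) · Φ)) ↑ 2
      ≈⟨ solve 4 (λ q b x z →
           let y = q :* b
               one = (x :^ 3 :- con (+ 27) :* y :^ 3) :* z
               r = y :^ 3 :* z
           in (y :* ((x :^ 2 :+ con (+ 3) :* x :* y :+ con (+ 9) :* y :^ 2) :* z)) :^ 2
              := con (+ 6) :* (r :* one) :+ con (+ 243) :* r :^ 2
                 :+ con (+ 27) :* ((q :^ 3) :^ 1 :* b :^ 4 :* x :^ 2 :* z :^ 2) :* q
                 :+ (con 1ℤ :* ((q :^ 3) :^ 0 :* b :^ 2 :* x :^ 4 :* z :^ 2)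
                     :+ con (+ 54) :* ((q :^ 3) :^ 1 :* b :^ 5 :* x :^ 1 :* z :^ 2)) :* (q :* q))
           ≋-refl q b A Φ ⟩
    ι (+ 6) · (B ↑ 3 · Φ · one) ⊕ ι (+ 243) · (B ↑ 3 · Φ) ↑ 2
      ⊕ ι (+ 27) · ((q ↑ 3) ↑ 1 · b ↑ 4 · A ↑ 2 · Φ ↑ 2) · q
      ⊕ (ι 1ℤ · ((q ↑ 3) ↑ 0 · b ↑ 2 · A ↑ 4 · Φ ↑ 2)
          ⊕ ι (+ 54) · ((q ↑ 3) ↑ 1 · b ↑ 5 · A ↑ 1 · Φ ↑ 2)) · (q · q)
      ≈⟨ ⊕-cong (⊕-cong
           (≋-trans (dil-⊕ _ _) (⊕-cong
             (dil-ι· (+ 6) (≋-trans (≋-sym (·-identityʳ _)) (·-cong dil-t (≋-sym [A³-27B³]Φ))))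
             (dil-ι· (+ 243) (≋-trans (dil-^ t 2) (^-congˡ 2 dil-t)))))
           (·-congʳ (dil-ι· (+ 27) (dil-monomial 1 4 2 2))))
           (·-congʳ (≋-trans (dil-⊕ _ _) (⊕-cong (dil-ι· 1ℤ (dil-monomial 0 2 4 2))
             (dil-ι· (+ 54) (dil-monomial 1 5 1 2))))) ⟨
    dil (ι (+ 6) · t ⊕ ι (+ 243) · t ↑ 2) ⊕ dil (ι (+ 27) · (q ↑ 1 · β ↑ 4 · α ↑ 2 · φ ↑ 2)) · q
      ⊕ dil (ι 1ℤ · (q ↑ 0 · β ↑ 2 · α ↑ 4 · φ ↑ 2)
          ⊕ ι (+ 54) · (q ↑ 1 · β ↑ 5 · α ↑ 1 · φ ↑ 2)) · (q · q) ∎)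
  where
  open ≋-Reasoning
  one : PS
  one = (A ↑ 3 ⊕ ⊝ (ι (+ 27) · B ↑ 3)) · Φ

part₀-x-rec : ∀ i → part 0 (x ↑ (3 + i)) ≋
  t · (part 0 (x ↑ i) ⊕ ι (+ 9) · part 0 (x ↑ (1 + i)) ⊕ ι (+ 27) · part 0 (x ↑ (2 + i)))
part₀-x-rec i = begin
  part 0 (x ↑ (3 + i))
    ≈⟨ part-cong 0 (≋-trans (^-homo-* x 3 i) (·-congʳ x-cubic)) ⟩
  part 0 (dil t · (ι 1ℤ ⊕ ι (+ 9) · x ⊕ ι (+ 27) · x ↑ 2) · x ↑ i)
    ≈⟨ part-cong 0 (solve 3 (λ t x y → t :* (con 1ℤ :+ con (+ 9) :* x :+ con (+ 27) :* x :^ 2) :* y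
         := t :* (y :+ con (+ 9) :* (x :* y) :+ con (+ 27) :* (x :* (x :* y)))) ≋-refl (dil t) x (x ↑ i)) ⟩
  part 0 (dil t · (x ↑ i ⊕ ι (+ 9) · x ↑ (1 + i) ⊕ ι (+ 27) · x ↑ (2 + i)))
    ≈⟨ part-dil· 0 t _ z≤n ⟩
  t · part 0 (x ↑ i ⊕ ι (+ 9) · x ↑ (1 + i) ⊕ ι (+ 27) · x ↑ (2 + i))
    ≈⟨ ·-congˡ (≋-trans (part-⊕₃ 0 _ _ _) (⊕-cong (⊕-congˡ (part-ι· 0 _ _ z≤n)) (part-ι· 0 _ _ z≤n))) ⟩
  t · (part 0 (x ↑ i) ⊕ ι (+ 9) · part 0 (x ↑ (1 + i)) ⊕ ι (+ 27) · part 0 (x ↑ (2 + i))) ∎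
  where open ≋-Reasoning

-- Support of m, and its rows as dissections of powers of x

m-rec : ∀ i j → m (suc i) (suc (suc j)) ≡
  + 27 ℤ.* m i (suc j) ℤ.+ + 9 ℤ.* m (i ∸ 1) (suc j) ℤ.+ m (i ∸ 2) (suc j)
m-rec zero                j = refl
m-rec (suc zero)          j = refl
m-rec (suc (suc zero))    j = refl
m-rec (suc (suc (suc i))) j = refl

m-combination-zero : ∀ {x y z} → x ≡ 0ℤ → y ≡ 0ℤ → z ≡ 0ℤ → + 27 ℤ.* x ℤ.+ + 9 ℤ.* y ℤ.+ z ≡ 0ℤ
m-combination-zero refl refl refl = refl

-- Each new column raises the row index by 1, 2 or 3. Together with `m-below` this confines the
-- support to j ≤ i ≤ 3j.
m-above : ∀ i j → i < j → m i j ≡ 0ℤ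
m-above zero    j             _         = refl
m-above (suc i) (suc (suc j)) (s≤s i<j) = trans (m-rec i j) (m-combination-zero
  (m-above i (suc j) i<j)
  (m-above (i ∸ 1) (suc j) (ℕₚ.≤-<-trans (ℕₚ.m∸n≤m i 1) i<j))
  (m-above (i ∸ 2) (suc j) (ℕₚ.≤-<-trans (ℕₚ.m∸n≤m i 2) i<j)))
m-above (suc i) (suc zero) (s≤s ())

m-below : ∀ i j → j * 3 < i → m i j ≡ 0ℤ
m-below (suc i) zero _ = refl
m-below (suc (suc (suc (suc i)))) (suc zero) _ = refl
m-below (suc (suc (suc i))) (suc (suc j)) (s≤s (s≤s (s≤s h))) = trans (m-rec (2 + i) j)
  (m-combination-zero (m-below (2 + i) (suc j) (ℕₚ.≤-trans h (ℕₚ.m≤n+m i 2)))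
    (m-below (1 + i) (suc j) (ℕₚ.≤-trans h (ℕₚ.n≤1+n i))) (m-below i (suc j) h))
m-below (suc zero) (suc j) (s≤s ())
m-below (suc (suc zero)) (suc j) (s≤s (s≤s ()))
m-below (suc (suc (suc zero))) (suc zero) (s≤s (s≤s (s≤s ())))

⨁₁ : ℕ → (ℕ → PS) → PS
⨁₁ zero    f = ι 0ℤ
⨁₁ (suc n) f = ⨁₁ n f ⊕ f (suc n)

⨁₁-cong : ∀ n {f g} → (∀ k → f (suc k) ≋ g (suc k)) → ⨁₁ n f ≋ ⨁₁ n g
⨁₁-cong zero    h = ≋-refl
⨁₁-cong (suc n) h = ⊕-cong (⨁₁-cong n h) (h n)

⨁₁-zero : ∀ n {f} → (∀ k → k < n → f (suc k) ≋ ι 0ℤ) → ⨁₁ n f ≋ ι 0ℤ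
⨁₁-zero zero    h = ≋-refl
⨁₁-zero (suc n) h = ≋-trans
  (⊕-cong (⨁₁-zero n λ k k<n → h k (ℕₚ.m≤n⇒m≤1+n k<n)) (h n ℕₚ.≤-refl))
  (solve 0 (con 0ℤ :+ con 0ℤ := con 0ℤ) ≋-refl)

⨁₁-⊕ : ∀ n f g → ⨁₁ n (λ k → f k ⊕ g k) ≋ ⨁₁ n f ⊕ ⨁₁ n g
⨁₁-⊕ zero    f g = solve 0 (con 0ℤ := con 0ℤ :+ con 0ℤ) ≋-refl
⨁₁-⊕ (suc n) f g = ≋-trans (⊕-congʳ (⨁₁-⊕ n f g))
  (solve 4 (λ a b c d → a :+ b :+ (c :+ d) := a :+ c :+ (b :+ d)) ≋-refl _ _ _ _)

⨁₁-distribˡ : ∀ n c f → c · ⨁₁ n f ≋ ⨁₁ n (λ k → c · f k)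
⨁₁-distribˡ zero    c f = solve 1 (λ c → c :* con 0ℤ := con 0ℤ) ≋-refl c
⨁₁-distribˡ (suc n) c f = ≋-trans
  (solve 3 (λ c x y → c :* (x :+ y) := c :* x :+ c :* y) ≋-refl c (⨁₁ n f) (f (suc n)))
  (⊕-congʳ (⨁₁-distribˡ n c f))

⨁₁-+ : ∀ l n f → ⨁₁ (l + n) f ≋ ⨁₁ l f ⊕ ⨁₁ n (λ k → f (l + k))
⨁₁-+ l zero    f = ≋-trans (≋-reflexive (cong (λ i → ⨁₁ i f) (ℕₚ.+-identityʳ l)))
  (solve 1 (λ x → x := x :+ con 0ℤ) ≋-refl (⨁₁ l f))
⨁₁-+ l (suc n) f = begin
  ⨁₁ (l + suc n) f
    ≡⟨ cong (λ i → ⨁₁ i f) (ℕₚ.+-suc l n) ⟩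
  ⨁₁ (l + n) f ⊕ f (suc (l + n))
    ≈⟨ ⊕-cong (⨁₁-+ l n f) (≋-reflexive (cong f (sym (ℕₚ.+-suc l n)))) ⟩
  ⨁₁ l f ⊕ ⨁₁ n (λ k → f (l + k)) ⊕ f (l + suc n)
    ≈⟨ solve 3 (λ x y z → x :+ y :+ z := x :+ (y :+ z)) ≋-refl _ _ _ ⟩
  ⨁₁ l f ⊕ ⨁₁ (suc n) (λ k → f (l + k)) ∎
  where open ≋-Reasoning

δ : ℕ → PS
δ zero    = ι 1ℤ
δ (suc _) = ι 0ℤ

-- m has no row describing part 0 (x ↑ 0) = 1, hence the correction δ.
row : ℕ → ℕ → PS
row i J = δ i ⊕ ⨁₁ J (λ j → ι (m i j) · t ↑ j)

-- The correction δ accounts for the entry m(3,1) = 1: it is t times the constant part of x^0. All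
-- other columns follow the recurrence of m.
row-rec : ∀ i J → row (3 + i) (suc J) ≋
  t · (row i J ⊕ ι (+ 9) · row (1 + i) J ⊕ ι (+ 27) · row (2 + i) J)
row-rec i J = begin
  ι 0ℤ ⊕ ⨁₁ (1 + J) (λ j → ι (m (3 + i) j) · t ↑ j)
    ≈⟨ ⊕-congˡ (≋-trans (⨁₁-+ 1 J _) (⊕-cong (⊕-congˡ (·-congʳ (first i))) (⨁₁-cong J next))) ⟩
  ι 0ℤ ⊕ ((ι 0ℤ ⊕ δ i · t ↑ 1)
    ⊕ ⨁₁ J (λ j → t · (f₀ j ⊕ ι (+ 9) · f₁ j ⊕ ι (+ 27) · f₂ j)))
    ≈⟨ ⊕-congˡ (⊕-congˡ (≋-trans (≋-sym (⨁₁-distribˡ J t _)) (·-congˡ (≋-trans (⨁₁-⊕ J _ _)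
         (⊕-cong (≋-trans (⨁₁-⊕ J _ _) (⊕-congˡ (≋-sym (⨁₁-distribˡ J _ _))))
           (≋-sym (⨁₁-distribˡ J _ _))))))) ⟩
  ι 0ℤ ⊕ ((ι 0ℤ ⊕ δ i · t ↑ 1)
    ⊕ t · (⨁₁ J f₀ ⊕ ι (+ 9) · ⨁₁ J f₁ ⊕ ι (+ 27) · ⨁₁ J f₂))
    ≈⟨ solve 5 (λ t d x y z →
         con 0ℤ :+ ((con 0ℤ :+ d :* t :^ 1) :+ t :* (x :+ con (+ 9) :* y :+ con (+ 27) :* z))
         := t :* ((d :+ x) :+ con (+ 9) :* (con 0ℤ :+ y) :+ con (+ 27) :* (con 0ℤ :+ z)))
         ≋-refl t (δ i) (⨁₁ J f₀) (⨁₁ J f₁) (⨁₁ J f₂) ⟩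
  t · (row i J ⊕ ι (+ 9) · row (1 + i) J ⊕ ι (+ 27) · row (2 + i) J) ∎
  where
  open ≋-Reasoning
  f₀ f₁ f₂ : ℕ → PS
  f₀ j = ι (m i j) · t ↑ j
  f₁ j = ι (m (1 + i) j) · t ↑ j
  f₂ j = ι (m (2 + i) j) · t ↑ j
  first : ∀ i → ι (m (3 + i) 1) ≋ δ i
  first zero    = ≋-refl
  first (suc i) = ≋-refl
  next : ∀ k → ι (m (3 + i) (suc (suc k))) · t ↑ suc (suc k)
    ≋ t · (f₀ (suc k) ⊕ ι (+ 9) · f₁ (suc k) ⊕ ι (+ 27) · f₂ (suc k))
  next k = ≋-trans (·-congʳ (≋-trans (≋-reflexive (cong ι (m-rec (2 + i) k)))
      (≋-trans (ι-+ _ _) (⊕-congʳ (≋-trans (ι-+ _ _) (⊕-cong (ι-* _ _) (ι-* _ _)))))))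
    (solve 5 (λ t w x y z → (con (+ 27) :* z :+ con (+ 9) :* y :+ x) :* (t :* w)
        := t :* (x :* w :+ con (+ 9) :* (y :* w) :+ con (+ 27) :* (z :* w)))
      ≋-refl t (t ↑ suc k) (ι (m i (suc k))) (ι (m (1 + i) (suc k))) (ι (m (2 + i) (suc k))))

-- The bound i ≤ J ensures that no nonzero entry of the row is cut off.
part₀-x^ : ∀ i J → i ≤ J → part 0 (x ↑ i) ≋ row i J
part₀-x^ zero J _ = ≋-trans (part₀-ι 1ℤ) (≋-sym (≋-trans
  (⊕-congˡ (⨁₁-zero J λ k _ → solve 1 (λ x → con 0ℤ :* x := con 0ℤ) ≋-refl (t ↑ suc k)))
  (solve 0 (con 1ℤ :+ con 0ℤ := con 1ℤ) ≋-refl)))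
part₀-x^ (suc zero) (suc J) _ = ≋-trans (part-cong 0 (·-identityʳ x)) (≋-trans part₀-x (≋-sym (≋-trans
  (⊕-congˡ (≋-trans (⨁₁-+ 1 J _)
    (⊕-congˡ (⨁₁-zero J λ k _ → solve 1 (λ x → con 0ℤ :* x := con 0ℤ) ≋-refl (t ↑ suc (suc k))))))
  (solve 1 (λ t → con 0ℤ :+ ((con 0ℤ :+ con (+ 9) :* t :^ 1) :+ con 0ℤ) := con (+ 9) :* t) ≋-refl t))))
part₀-x^ (suc (suc zero)) (suc (suc J)) _ = ≋-trans part₀-x² (≋-sym (≋-trans
  (⊕-congˡ (≋-trans (⨁₁-+ 2 J _)
    (⊕-congˡ (⨁₁-zero J λ k _ → solve 1 (λ x → con 0ℤ :* x := con 0ℤ) ≋-refl (t ↑ suc (suc (suc k)))))))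
  (solve 1 (λ t → con 0ℤ :+ ((con 0ℤ :+ con (+ 6) :* t :^ 1 :+ con (+ 243) :* t :^ 2) :+ con 0ℤ)
    := con (+ 6) :* t :+ con (+ 243) :* t :^ 2) ≋-refl t)))
part₀-x^ (suc (suc (suc i))) (suc J) (s≤s h) = ≋-trans (part₀-x-rec i) (≋-trans
  (·-congˡ (⊕-cong (⊕-cong (part₀-x^ i J (ℕₚ.≤-trans (ℕₚ.m≤n+m i 2) h))
    (·-congˡ (part₀-x^ (1 + i) J (ℕₚ.≤-trans (ℕₚ.n≤1+n (1 + i)) h)))) (·-congˡ (part₀-x^ (2 + i) J h))))
  (≋-sym (row-rec i J)))
part₀-x^ (suc (suc zero)) (suc zero) (s≤s ())

-- t is q times a unit, so cancelling t reduces to cancelling q, which is a shift of coefficients.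
t-cancel : ∀ l {f g} → t ↑ l · f ≋ t ↑ l · g → f ≋ g
t-cancel zero    {f} {g} p = ≋-trans (≋-sym (·-identityˡ f)) (≋-trans p (·-identityˡ g))
t-cancel (suc l) {f} {g} p = t-cancel l (q-cancel (begin
  q · (t ↑ l · f)       ≈⟨ expand (t ↑ l · f) ⟩
  w · (t · (t ↑ l · f)) ≈⟨ ·-congˡ (·-assoc t (t ↑ l) f) ⟨
  w · (t ↑ suc l · f)   ≈⟨ ·-congˡ p ⟩
  w · (t ↑ suc l · g)   ≈⟨ ·-congˡ (·-assoc t (t ↑ l) g) ⟩
  w · (t · (t ↑ l · g)) ≈⟨ expand (t ↑ l · g) ⟨
  q · (t ↑ l · g)       ∎))
  where
  open ≋-Reasoning
  w : PS
  w = u ↑ 12 · E 1 ↑ 12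
  expand : ∀ h → q · h ≋ w · (t · h)
  expand h = begin
    q · h
      ≈⟨ solve 2 (λ q h → q :* h := con 1ℤ :* con 1ℤ :* (q :* h)) ≋-refl q h ⟩
    ι 1ℤ · ι 1ℤ · (q · h)
      ≈⟨ ·-congʳ (·-cong (^-inverse 12 E₃·u) (^-inverse 12 E·v)) ⟨
    E 3 ↑ 12 · u ↑ 12 · (E 1 ↑ 12 · v ↑ 12) · (q · h)
      ≈⟨ solve 6 (λ q a b c d h → a :* b :* (c :* d) :* (q :* h) := b :* c :* (q :* (a :* d) :* h)) ≋-refl
           q (E 3 ↑ 12) (u ↑ 12) (E 1 ↑ 12) (v ↑ 12) h ⟩
    w · (t · h) ∎

-- The powers of E₃ cancel between the two factors, leaving q⁴ E₉¹²/E₁¹². Hence t^l is a power of x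
-- divided by a series in q³.
t·dil-t : t · dil t ≋ x ↑ 4
t·dil-t = begin
  t · dil t
    ≈⟨ ·-congˡ (≋-trans (dil-· _ _) (·-cong (≋-sym q^3≋dil)
         (≋-trans (dil-· _ _) (·-cong (dil-^ _ 12) (dil-^ _ 12))))) ⟩
  t · (q ↑ 3 · (d ↑ 12 · u ↑ 12))
    ≈⟨ solve 5 (λ q e v d u → q :* (e :^ 12 :* v :^ 12) :* (q :^ 3 :* (d :^ 12 :* u :^ 12))
         := (q :* (d :^ 3 :* v :^ 3)) :^ 4 :* (e :* u) :^ 12) ≋-refl q (E 3) v d u ⟩
  x ↑ 4 · (E 3 · u) ↑ 12
    ≈⟨ ·-congˡ (≋-trans (^-congˡ 12 E₃·u) (1^ 12)) ⟩
  x ↑ 4 · ι 1ℤ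
    ≈⟨ ·-identityʳ _ ⟩
  x ↑ 4 ∎
  where
  open ≋-Reasoning
  d : PS
  d = dil (E 3)

t^·dil-t^ : ∀ l → t ↑ l · dil (t ↑ l) ≋ x ↑ (4 * l)
t^·dil-t^ l = begin
  t ↑ l · dil (t ↑ l)   ≈⟨ ·-congˡ (dil-^ t l) ⟩
  t ↑ l · dil t ↑ l     ≈⟨ ^-distrib-* t (dil t) l ⟨
  (t · dil t) ↑ l       ≈⟨ ^-congˡ l t·dil-t ⟩
  (x ↑ 4) ↑ l           ≈⟨ ^-assocʳ x 4 l ⟩
  x ↑ (4 * l)         ∎
  where open ≋-Reasoning

-- The hypothesis says f = x^(i+1) w(q³)/t(q³)^l, so the part is w t^(-l) times row i + 1 of m. By
-- `vanish` that row starts beyond column l, which leaves positive powers of t only.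
part₀-quotient : ∀ l i K {f w} → suc i ≤ l + K → (∀ j → j ≤ l → m (suc i) j ≡ 0ℤ) →
  f · dil (t ↑ l) ≋ x ↑ suc i · dil w →
  part 0 f ≋ ⨁₁ K (λ k → ι (m (suc i) (l + k)) · (t ↑ k · w))
part₀-quotient l i K {f} {w} i<l+K vanish p = t-cancel l (begin
  t ↑ l · part 0 f
    ≈⟨ part-dil· 0 (t ↑ l) f z≤n ⟨
  part 0 (dil (t ↑ l) · f)
    ≈⟨ part-cong 0 (≋-trans (·-comm _ _) (≋-trans p (·-comm _ _))) ⟩
  part 0 (dil w · x ↑ suc i)
    ≈⟨ part-dil· 0 w _ z≤n ⟩
  w · part 0 (x ↑ suc i)
    ≈⟨ ·-congˡ (part₀-x^ (suc i) (l + K) i<l+K) ⟩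
  w · (ι 0ℤ ⊕ ⨁₁ (l + K) (λ j → ι (m (suc i) j) · t ↑ j))
    ≈⟨ ·-congˡ (⊕-congˡ (≋-trans (⨁₁-+ l K _) (⊕-congʳ (⨁₁-zero l λ j j<l →
         ≋-trans (·-congʳ (≋-reflexive (cong ι (vanish (suc j) j<l))))
           (solve 1 (λ x → con 0ℤ :* x := con 0ℤ) ≋-refl (t ↑ suc j)))))) ⟩
  w · (ι 0ℤ ⊕ (ι 0ℤ ⊕ ⨁₁ K (λ k → ι (m (suc i) (l + k)) · t ↑ (l + k))))
    ≈⟨ solve 2 (λ w x → w :* (con 0ℤ :+ (con 0ℤ :+ x)) := w :* x) ≋-refl w _ ⟩
  w · ⨁₁ K (λ k → ι (m (suc i) (l + k)) · t ↑ (l + k))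
    ≈⟨ ⨁₁-distribˡ K w _ ⟩
  ⨁₁ K (λ k → w · (ι (m (suc i) (l + k)) · t ↑ (l + k)))
    ≈⟨ ⨁₁-cong K (λ k → ≋-trans (·-congˡ (·-congˡ (^-homo-* t l (suc k))))
         (solve 4 (λ w c r s → w :* (c :* (r :* s)) := r :* (c :* (s :* w))) ≋-refl
           w (ι (m (suc i) (l + suc k))) (t ↑ l) (t ↑ suc k))) ⟩
  ⨁₁ K (λ k → t ↑ l · (ι (m (suc i) (l + k)) · (t ↑ k · w)))
    ≈⟨ ⨁₁-distribˡ K (t ↑ l) _ ⟨
  t ↑ l · ⨁₁ K (λ k → ι (m (suc i) (l + k)) · (t ↑ k · w)) ∎)
  where open ≋-Reasoning

-- The matrix a

sum1-cong : ∀ n {f g} → (∀ k → k < n → f (suc k) ≡ g (suc k)) → sum1 n f ≡ sum1 n g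
sum1-cong zero    h = refl
sum1-cong (suc n) h =
  cong₂ ℤ._+_ (sum1-cong n λ k k<n → h k (ℕₚ.m≤n⇒m≤1+n k<n)) (h n ℕₚ.≤-refl)

sum1-+ : ∀ n f g → sum1 n (λ k → f k ℤ.+ g k) ≡ sum1 n f ℤ.+ sum1 n g
sum1-+ zero    f g = refl
sum1-+ (suc n) f g = trans (cong (ℤ._+ (f (suc n) ℤ.+ g (suc n))) (sum1-+ n f g))
  (S.solve 4 (λ a b c d → (a S.:+ b) S.:+ (c S.:+ d) S.:= (a S.:+ c) S.:+ (b S.:+ d)) refl
    (sum1 n f) (sum1 n g) (f (suc n)) (g (suc n)))
  where module S = +-*-Solver

sum1-*ˡ : ∀ n c f → c ℤ.* sum1 n f ≡ sum1 n (λ k → c ℤ.* f k)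
sum1-*ˡ zero    c f = ℤₚ.*-zeroʳ c
sum1-*ˡ (suc n) c f = trans (ℤₚ.*-distribˡ-+ c (sum1 n f) _) (cong (ℤ._+ c ℤ.* f (suc n)) (sum1-*ˡ n c f))

sum1-*ʳ : ∀ n c f → sum1 n f ℤ.* c ≡ sum1 n (λ k → f k ℤ.* c)
sum1-*ʳ zero    c f = refl
sum1-*ʳ (suc n) c f = trans (ℤₚ.*-distribʳ-+ c (sum1 n f) _) (cong (ℤ._+ f (suc n) ℤ.* c) (sum1-*ʳ n c f))

sum1-0 : ∀ n → sum1 n (λ _ → 0ℤ) ≡ 0ℤ
sum1-0 zero    = refl
sum1-0 (suc n) = trans (ℤₚ.+-identityʳ _) (sum1-0 n)

sum1-swap : ∀ n k (f : ℕ → ℕ → ℤ) → sum1 n (λ i → sum1 k (f i)) ≡ sum1 k (λ j → sum1 n (λ i → f i j))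
sum1-swap zero    k f = sym (sum1-0 k)
sum1-swap (suc n) k f = trans (cong (ℤ._+ sum1 k (f (suc n))) (sum1-swap n k f))
  (sym (sum1-+ k (λ j → sum1 n (λ i → f i j)) (f (suc n))))

sum1-stable : ∀ {M N} f → (∀ i → M < i → f i ≡ 0ℤ) → M ≤ N → sum1 N f ≡ sum1 M f
sum1-stable {M} {N} f h M≤N = trans (cong (λ i → sum1 i f) (sym (ℕₚ.m∸n+n≡m M≤N))) (go (N ∸ M))
  where
  go : ∀ d → sum1 (d + M) f ≡ sum1 M f
  go zero    = refl
  go (suc d) = trans (cong₂ ℤ._+_ (go d) (h _ (s≤s (ℕₚ.m≤n+m M d)))) (ℤₚ.+-identityʳ _)

-- Both sums are compared with the sum up to M + N, so the two bounds need not be ordered.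
sum1-range : ∀ M N f → (∀ i → M < i → f i ≡ 0ℤ) → (∀ i → N < i → f i ≡ 0ℤ) → sum1 M f ≡ sum1 N f
sum1-range M N f hM hN = trans (sym (sum1-stable f hM (ℕₚ.m≤m+n M N))) (sum1-stable f hN (ℕₚ.m≤n+m N M))

⨁₁-at : ∀ K (c : ℕ → ℤ) (s : ℕ → PS) n → ⨁₁ K (λ k → ι (c k) · s k) n ≡ sum1 K (λ k → c k ℤ.* s k n)
⨁₁-at zero    c s n = ι0 n
⨁₁-at (suc K) c s n = trans (⊕-at _ _ n) (cong₂ ℤ._+_ (⨁₁-at K c s n) (ι· (c (suc K)) (s (suc K)) n))

t^-low : ∀ k {n} w → n < k → (t ↑ k · w) n ≡ 0ℤ
t^-low k {n} w n<k = trans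
  (at (≋-trans (·-congʳ (^-distrib-* q r k)) (·-assoc (q ↑ k) (r ↑ k) w)) n)
  (trans (at≤ (q^≋[]0 k (r ↑ k · w) n<k) n ℕₚ.≤-refl) (ι0 n))
  where
  r : PS
  r = E 3 ↑ 12 · v ↑ 12

*-zeroʳ-≡ : ∀ x {y} → y ≡ 0ℤ → x ℤ.* y ≡ 0ℤ
*-zeroʳ-≡ x refl = ℤₚ.*-zeroʳ x

-- The sum ends for two reasons: the row of m ends, and t^k starts at q^k. Passing from the first
-- bound to the second makes the range independent of l, so that the order of summation can be
-- exchanged.
part₀-quotient-at : ∀ l i K {f w} → suc i ≤ l + K → (∀ j → j ≤ l → m (suc i) j ≡ 0ℤ) →
  f · dil (t ↑ l) ≋ x ↑ suc i · dil w → ∀ n →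
  f (n * 3) ≡ sum1 n (λ k → m (suc i) (l + k) ℤ.* (t ↑ k · w) n)
part₀-quotient-at l i K {f} {w} i<l+K vanish p n = trans
  (trans (at (part₀-quotient l i K i<l+K vanish p) n) (⨁₁-at K _ (λ k → t ↑ k · w) n))
  (sum1-range K n _
    (λ k K<k → cong (ℤ._* (t ↑ k · w) n) (m-above (suc i) (l + k)
      (ℕₚ.≤-<-trans i<l+K (ℕₚ.+-monoʳ-< l K<k))))
    (λ k n<k → *-zeroʳ-≡ (m (suc i) (l + k)) (t^-low k w n<k)))

-- Exchanging the order of summation turns the dissection of each t^l into the recurrence for a.
transfer : ∀ r (e : ℕ → ℕ) N n (s : ℕ → ℤ) (T : ℕ → ℤ) →
  (∀ k → a (suc (suc r)) k ≡ sum1 (3 * k) (λ l → a (suc r) l ℤ.* m (e l) (l + k))) →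
  (∀ l k → N < l → k ≤ suc n → (l + k) * 3 < e l) →
  (∀ l k → 3 * k < l → (l + k) * 3 < e l) →
  (∀ l → s (suc l) ≡ sum1 (suc n) (λ k → m (e (suc l)) (suc l + k) ℤ.* T k)) →
  sum1 N (λ l → a (suc r) l ℤ.* s l) ≡ sum1 (suc n) (λ k → a (suc (suc r)) k ℤ.* T k)
transfer r e N n s T a-rec hN h3k hs = begin
  sum1 N (λ l → a (suc r) l ℤ.* s l)
    ≡⟨ sum1-cong N (λ l _ → trans (cong (a (suc r) (suc l) ℤ.*_) (hs l))
         (sum1-*ˡ (suc n) (a (suc r) (suc l)) (λ k → m (e (suc l)) (suc l + k) ℤ.* T k))) ⟩
  sum1 N (λ l → sum1 (suc n) (λ k → a (suc r) l ℤ.* (m (e l) (l + k) ℤ.* T k)))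
    ≡⟨ sum1-swap N (suc n) _ ⟩
  sum1 (suc n) (λ k → sum1 N (λ l → a (suc r) l ℤ.* (m (e l) (l + k) ℤ.* T k)))
    ≡⟨ sum1-cong (suc n) (λ k k<n → begin
         sum1 N (λ l → a (suc r) l ℤ.* (m (e l) (l + suc k) ℤ.* T (suc k)))
           ≡⟨ sum1-cong N (λ l _ → sym (ℤₚ.*-assoc (a (suc r) (suc l)) _ _)) ⟩
         sum1 N (λ l → a (suc r) l ℤ.* m (e l) (l + suc k) ℤ.* T (suc k))
           ≡⟨ sum1-*ʳ N _ _ ⟨
         sum1 N (λ l → a (suc r) l ℤ.* m (e l) (l + suc k)) ℤ.* T (suc k)
           ≡⟨ cong (ℤ._* T (suc k)) (trans
                (sum1-range N (3 * suc k) _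
                  (λ l N<l → *-zeroʳ-≡ (a (suc r) l) (m-below (e l) (l + suc k) (hN l (suc k) N<l k<n)))
                  (λ l k<l → *-zeroʳ-≡ (a (suc r) l) (m-below (e l) (l + suc k) (h3k l (suc k) k<l))))
                (sym (a-rec (suc k)))) ⟩
         a (suc (suc r)) (suc k) ℤ.* T (suc k) ∎) ⟩
  sum1 (suc n) (λ k → a (suc (suc r)) k ℤ.* T k) ∎
  where open ≡-Reasoning

-- The right-hand sides of the theorem with an extra factor q, hence read at index n + 1: the
-- summands are then t^l/E₃⁶ and t^l/E₁⁶.
oddSeries evenSeries : ℕ → ℕ → ℤ
oddSeries  r n = sum1 (suc n) (λ l → a r l ℤ.* (t ↑ l · u ↑ 6) (suc n))
evenSeries r n = sum1 (suc n) (λ l → a r l ℤ.* (t ↑ l · v ↑ 6) (suc n))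

-- By `m-below` this makes m(4l, l+k) vanish for l > 3k, the point where the sum defining `a` stops.
sum-bound : ∀ l k → 3 * k < l → (l + k) * 3 < 4 * l
sum-bound l k h = subst (_< 4 * l) (lhs l k)
  (subst (3 * l + 3 * k <_) (rhs l) (ℕₚ.+-monoʳ-< (3 * l) h))
  where
  lhs : ∀ l k → 3 * l + 3 * k ≡ (l + k) * 3
  lhs = solve-∀
  rhs : ∀ l → 3 * l + l ≡ 4 * l
  rhs = solve-∀

-- The two additional rows in 4l + 2 relax the bound on l by two. This matches the even series being
-- read at index 3n, where the odd one is read at 3n + 2.
sum-bound₂ : ∀ l k → 3 * k < 2 + l → (l + k) * 3 < 4 * l + 2
sum-bound₂ l k h = subst (_< 4 * l + 2) (lhs l k)
  (subst (3 * l + 3 * k <_) (rhs l) (ℕₚ.+-monoʳ-< (3 * l) h))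
  where
  lhs : ∀ l k → 3 * l + 3 * k ≡ (l + k) * 3
  lhs = solve-∀
  rhs : ∀ l → 3 * l + (2 + l) ≡ 4 * l + 2
  rhs = solve-∀

3k≤ : ∀ k n → k ≤ suc n → 3 * k ≤ 3 + n * 3
3k≤ k n k≤ = subst (3 * k ≤_) (ℕₚ.*-comm 3 (suc n)) (ℕₚ.*-monoʳ-≤ 3 k≤)

m-4l-vanish : ∀ l j → j ≤ suc l → m (4 * suc l) j ≡ 0ℤ
m-4l-vanish l j j≤l = m-below (4 * suc l) j (ℕₚ.≤-<-trans (ℕₚ.*-monoˡ-≤ 3 j≤l)
  (subst (suc l * 3 <_) (ℕₚ.*-comm (suc l) 4) (ℕₚ.*-monoʳ-< (suc l) ℕₚ.≤-refl)))

-- With the extra factor q, index 3n + 2 becomes 3(n+1), a multiple of 3. Row 4l appears because t^l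
-- u⁶ t(q³)^l = x^(4l) u⁶, and u⁶ is v⁶ in q³.
odd⇒even : ∀ r → odd? (suc r) ≡ true → ∀ n →
  oddSeries (suc r) (2 + n * 3) ≡ evenSeries (suc (suc r)) n
odd⇒even r isOdd n = transfer r (4 *_) (3 + n * 3) n _ (λ k → (t ↑ k · v ↑ 6) (suc n))
  (λ k → cong (λ b → sum1 (3 * k) (λ l → a (suc r) l ℤ.*
    m (if b then 4 * l else 4 * l + 2) (l + k))) isOdd)
  (λ l k N<l k≤ → sum-bound l k (ℕₚ.≤-<-trans (3k≤ k n k≤) N<l))
  sum-bound
  (λ l → part₀-quotient-at (suc l) _ (3 * suc l) {t ↑ suc l · u ↑ 6} {v ↑ 6} ℕₚ.≤-refl (m-4l-vanish l)
    (≋-trans (solve 3 (λ x y z → x :* y :* z := x :* z :* y) ≋-refl (t ↑ suc l) (u ↑ 6) (dil (t ↑ suc l)))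
      (·-cong (t^·dil-t^ (suc l)) (≋-sym (dil-^ v 6)))) (suc n))

-- x² already contains q²/E₁⁶; its remaining factor E₉⁶ is cancelled by a series in q³.
q²v⁶ : q · (q · v ↑ 6) ≋ x ↑ 2 · dil (u ↑ 6)
q²v⁶ = begin
  q · (q · v ↑ 6)
    ≈⟨ solve 2 (λ q w → q :* (q :* w) := q :* (q :* w) :* con 1ℤ) ≋-refl q (v ↑ 6) ⟩
  q · (q · v ↑ 6) · ι 1ℤ
    ≈⟨ ·-congˡ (^-inverse 6 dilE₃·dilu) ⟨
  q · (q · v ↑ 6) · (dil (E 3) ↑ 6 · dil u ↑ 6)
    ≈⟨ solve 4 (λ q v d w → q :* (q :* v :^ 6) :* (d :^ 6 :* w) := (q :* (d :^ 3 :* v :^ 3)) :^ 2 :* w)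
         ≋-refl q v (dil (E 3)) (dil u ↑ 6) ⟩
  x ↑ 2 · dil u ↑ 6
    ≈⟨ ·-congˡ (dil-^ u 6) ⟨
  x ↑ 2 · dil (u ↑ 6) ∎
  where open ≋-Reasoning

q²-shift : ∀ f n → (q · (q · f)) (2 + n) ≡ f n
q²-shift f n = trans (q· (q · f) (suc n)) (q· f n)

-- With the extra factor q, index 3n becomes 3n + 1, and q² moves it to 3(n+1). The same q² turns v⁶
-- into x² times a series in q³, which shifts row 4l to row 4l + 2.
even⇒odd : ∀ r → odd? (suc r) ≡ false → ∀ n →
  evenSeries (suc r) (n * 3) ≡ oddSeries (suc (suc r)) n
even⇒odd r isEven n = transfer r (λ l → 4 * l + 2) (1 + n * 3) n _ (λ k → (t ↑ k · u ↑ 6) (suc n))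
  (λ k → cong (λ b → sum1 (3 * k) (λ l → a (suc r) l ℤ.*
    m (if b then 4 * l else 4 * l + 2) (l + k))) isEven)
  (λ l k N<l k≤ → sum-bound₂ l k (ℕₚ.≤-<-trans (3k≤ k n k≤) (s≤s (s≤s N<l))))
  (λ l k h → sum-bound₂ l k (ℕₚ.≤-trans h (ℕₚ.m≤n+m l 2)))
  (λ l → trans (sym (q²-shift (t ↑ suc l · v ↑ 6) (1 + n * 3)))
    (part₀-quotient-at (suc l) _ (3 * suc l + 2) {q · (q · (t ↑ suc l · v ↑ 6))} {u ↑ 6}
      (ℕₚ.≤-reflexive (ℕₚ.+-assoc (suc l) (3 * suc l) 2))
      (λ j j≤l → m-below _ j (ℕₚ.<-≤-trans (ℕₚ.≤-<-trans (ℕₚ.*-monoˡ-≤ 3 j≤l)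
        (subst (suc l * 3 <_) (ℕₚ.*-comm (suc l) 4) (ℕₚ.*-monoʳ-< (suc l) ℕₚ.≤-refl))) (ℕₚ.m≤m+n _ 2)))
      (begin
        q · (q · (t ↑ suc l · v ↑ 6)) · dil (t ↑ suc l)
          ≈⟨ solve 4 (λ q x y z → q :* (q :* (x :* y)) :* z := x :* z :* (q :* (q :* y)))
               ≋-refl q (t ↑ suc l) (v ↑ 6) (dil (t ↑ suc l)) ⟩
        t ↑ suc l · dil (t ↑ suc l) · (q · (q · v ↑ 6))
          ≈⟨ ·-cong (t^·dil-t^ (suc l)) q²v⁶ ⟩
        x ↑ (4 * suc l) · (x ↑ 2 · dil (u ↑ 6))
          ≈⟨ ≋-trans (≋-sym (·-assoc _ _ _)) (·-congʳ (≋-sym (^-homo-* x (4 * suc l) 2))) ⟩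
        x ↑ (4 * suc l + 2) · dil (u ↑ 6) ∎)
      (suc n)))
  where open ≋-Reasoning

-- Generating functions along the arithmetic progressions

invS-powS : ∀ k → invS (powS (E 1) k) ≋ v ↑ k
invS-powS k = inverse-unique (·-inverseʳ (powS (E 1) k) (constant k))
  (≋-trans (·-congʳ (powS≋^ (E 1) k)) (^-inverse k E·v))
  where
  constant : ∀ k → powS (E 1) k 0 ≡ 1ℤ
  constant zero    = refl
  constant (suc k) = cong (ℤ._* 1ℤ) (constant k)

-- 1/E₁⁶ is t^0 v⁶, the case l = 0 of the even step, where 4l + 2 = 2. Accordingly a(1,·) is row 2
-- of m.
firstSeries : ∀ n → p13 (1 + n * 3) ≡ oddSeries 1 n
firstSeries n = begin
  p13 (1 + n * 3)
    ≡⟨ at (invS-powS 6) _ ⟩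
  (v ↑ 6) (1 + n * 3)
    ≡⟨ q²-shift (v ↑ 6) _ ⟨
  (q · (q · v ↑ 6)) (suc n * 3)
    ≡⟨ part₀-quotient-at 0 1 2 ℕₚ.≤-refl (λ { zero _ → refl })
         (≋-trans (·-congˡ (dil-ι 1ℤ)) (≋-trans (·-identityʳ _) q²v⁶)) (suc n) ⟩
  sum1 (suc n) (λ k → m 2 k ℤ.* (t ↑ k · u ↑ 6) (suc n))
    ≡⟨ sum1-cong (suc n) (λ k _ → cong (ℤ._* (t ↑ suc k · u ↑ 6) (suc n)) (row₂ k)) ⟩
  oddSeries 1 n ∎
  where
  open ≡-Reasoning
  row₂ : ∀ k → m 2 (suc k) ≡ a 1 (suc k)
  row₂ zero          = refl
  row₂ (suc zero)    = refl
  row₂ (suc (suc k)) = refl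

t^-suc : ∀ l → t ↑ suc l ≋ q · (q ↑ l · (E 3 ↑ (12 * suc l) · v ↑ (12 * suc l)))
t^-suc l = begin
  t ↑ suc l
    ≈⟨ ≋-trans (^-distrib-* q _ (suc l)) (·-congˡ (^-distrib-* (E 3 ↑ 12) (v ↑ 12) (suc l))) ⟩
  q · q ↑ l · ((E 3 ↑ 12) ↑ suc l · (v ↑ 12) ↑ suc l)
    ≈⟨ ≋-trans (·-assoc _ _ _) (·-congˡ (·-congˡ
         (·-cong (^-assocʳ (E 3) 12 (suc l)) (^-assocʳ v 12 (suc l))))) ⟩
  q · (q ↑ l · (E 3 ↑ (12 * suc l) · v ↑ (12 * suc l))) ∎
  where open ≋-Reasoning

summand-at : ∀ l i k {f} n → f ≋ q · (q ↑ l · (E 3 ↑ i · v ↑ k)) →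
  f (suc n) ≡ shiftS l (powS (E 3) i ⊗ invS (powS (E 1) k)) n
summand-at l i k n p = trans (at p (suc n)) (trans (q· _ n) (sym (at (≋-trans (shiftS≋ l _)
  (·-congˡ (≋-trans (≋-sym (·≋⊗ _ _)) (·-cong (powS≋^ (E 3) i) (invS-powS k))))) n)))

oddSeries≡rhsOdd : ∀ r n → oddSeries r n ≡ rhsOdd r n
oddSeries≡rhsOdd r n = sum1-cong (suc n) λ l _ → cong (a r (suc l) ℤ.*_)
  (summand-at l (12 * suc l ∸ 6) (12 * suc l) n (begin
    t ↑ suc l · u ↑ 6
      ≈⟨ ·-congʳ (≋-trans (t^-suc l) (·-congˡ (·-congˡ (·-congʳ (split l))))) ⟩
    q · (q ↑ l · (E 3 ↑ 6 · E 3 ↑ (12 * suc l ∸ 6) · v ↑ (12 * suc l))) · u ↑ 6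
      ≈⟨ solve 6 (λ q x e f w u → q :* (x :* (e :* f :* w)) :* u := e :* u :* (q :* (x :* (f :* w)))) ≋-refl
           q (q ↑ l) (E 3 ↑ 6) (E 3 ↑ (12 * suc l ∸ 6)) (v ↑ (12 * suc l)) (u ↑ 6) ⟩
    E 3 ↑ 6 · u ↑ 6 · (q · (q ↑ l · (E 3 ↑ (12 * suc l ∸ 6) · v ↑ (12 * suc l))))
      ≈⟨ ≋-trans (·-congʳ (^-inverse 6 E₃·u)) (·-identityˡ _) ⟩
    q · (q ↑ l · (E 3 ↑ (12 * suc l ∸ 6) · v ↑ (12 * suc l))) ∎))
  where
  open ≋-Reasoning
  split : ∀ l → E 3 ↑ (12 * suc l) ≋ E 3 ↑ 6 · E 3 ↑ (12 * suc l ∸ 6)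
  split l = ≋-trans (≋-reflexive (cong (E 3 ↑_) (sym (ℕₚ.m+[n∸m]≡n 6≤))))
    (^-homo-* (E 3) 6 (12 * suc l ∸ 6))
    where
    6≤ : 6 ≤ 12 * suc l
    6≤ = ℕₚ.≤-trans (ℕₚ.m≤m+n 6 6) (ℕₚ.m≤m*n 12 (suc l))

evenSeries≡rhsEven : ∀ r n → evenSeries r n ≡ rhsEven r n
evenSeries≡rhsEven r n = sum1-cong (suc n) λ l _ → cong (a r (suc l) ℤ.*_)
  (summand-at l (12 * suc l) (12 * suc l + 6) n (begin
    t ↑ suc l · v ↑ 6
      ≈⟨ ·-congʳ (t^-suc l) ⟩
    q · (q ↑ l · (E 3 ↑ (12 * suc l) · v ↑ (12 * suc l))) · v ↑ 6
      ≈⟨ solve 5 (λ q x e w v → q :* (x :* (e :* w)) :* v := q :* (x :* (e :* (w :* v)))) ≋-refl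
           q (q ↑ l) (E 3 ↑ (12 * suc l)) (v ↑ (12 * suc l)) (v ↑ 6) ⟩
    q · (q ↑ l · (E 3 ↑ (12 * suc l) · (v ↑ (12 * suc l) · v ↑ 6)))
      ≈⟨ ·-congˡ (·-congˡ (·-congˡ (^-homo-* v (12 * suc l) 6))) ⟨
    q · (q ↑ l · (E 3 ↑ (12 * suc l) · v ↑ (12 * suc l + 6))) ∎))
  where open ≋-Reasoning

-- (3^(2j+1) + 1)/4, accumulated step by step: extracting residue 2 from the progression modulo
-- 3^(2j+1) adds 2·3^(2j+1), and the following extraction of residue 0 adds nothing.
offset : ℕ → ℕ
offset zero    = 1
offset (suc j) = 2 * 3 ^ (1 + 2 * j) + offset j

3^-suc : ∀ j → 3 ^ (1 + 2 * suc j) ≡ 9 * 3 ^ (1 + 2 * j)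
3^-suc j = trans (cong (λ i → 3 ^ suc i) (ℕₚ.*-suc 2 j)) (9* (3 ^ (1 + 2 * j)))
  where
  9* : ∀ y → 3 * (3 * y) ≡ 9 * y
  9* = solve-∀

offset-spec : ∀ j → (3 ^ (1 + 2 * j) + 1) / 4 ≡ offset j
offset-spec j = trans (cong (_/ 4) (go j)) (ℕ÷.m*n/n≡m (offset j) 4)
  where
  open ≡-Reasoning
  go : ∀ j → 3 ^ (1 + 2 * j) + 1 ≡ offset j * 4
  go zero    = refl
  go (suc j) = begin
    3 ^ (1 + 2 * suc j) + 1   ≡⟨ cong (_+ 1) (3^-suc j) ⟩
    9 * y + 1                      ≡⟨ regroup y ⟩
    8 * y + (y + 1)              ≡⟨ cong (λ z → 8 * y + z) (go j) ⟩
    8 * y + offset j * 4         ≡⟨ factor y (offset j) ⟩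
    (2 * y + offset j) * 4       ∎
    where
    y : ℕ
    y = 3 ^ (1 + 2 * j)
    regroup : ∀ y → 9 * y + 1 ≡ 8 * y + (y + 1)
    regroup = solve-∀
    factor : ∀ y c → 8 * y + c * 4 ≡ (2 * y + c) * 4
    factor = solve-∀

odd?-1+2* : ∀ j → odd? (1 + 2 * j) ≡ true
odd?-1+2* zero    = refl
odd?-1+2* (suc j) = trans (cong (λ i → odd? (suc i)) (ℕₚ.*-suc 2 j)) (odd?-1+2* j)

odd?-2+2* : ∀ j → odd? (2 + 2 * j) ≡ false
odd?-2+2* zero    = refl
odd?-2+2* (suc j) = trans (cong (λ i → odd? (2 + i)) (ℕₚ.*-suc 2 j)) (odd?-2+2* j)

oddProgression : ∀ j n → p13 (3 ^ (1 + 2 * j) * n + offset j) ≡ oddSeries (1 + 2 * j) n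
evenProgression : ∀ j n → p13 (3 ^ (2 + 2 * j) * n + offset (suc j)) ≡ evenSeries (2 + 2 * j) n

oddProgression zero    n = trans (cong p13 (index n)) (firstSeries n)
  where
  index : ∀ n → 3 * n + 1 ≡ 1 + n * 3
  index = solve-∀
oddProgression (suc j) n = begin
  p13 (3 ^ (1 + 2 * suc j) * n + offset (suc j))
    ≡⟨ cong (λ i → p13 (i + offset (suc j)))
         (trans (cong (_* n) (3^-suc j)) (index (3 ^ (1 + 2 * j)) n)) ⟩
  p13 (3 ^ (2 + 2 * j) * (n * 3) + offset (suc j))
    ≡⟨ evenProgression j (n * 3) ⟩
  evenSeries (2 + 2 * j) (n * 3)
    ≡⟨ even⇒odd (1 + 2 * j) (odd?-2+2* j) n ⟩
  oddSeries (3 + 2 * j) n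
    ≡⟨ cong (λ i → oddSeries (suc i) n) (ℕₚ.*-suc 2 j) ⟨
  oddSeries (1 + 2 * suc j) n ∎
  where
  open ≡-Reasoning
  index : ∀ y n → 9 * y * n ≡ 3 * y * (n * 3)
  index = solve-∀

evenProgression j n = begin
  p13 (3 ^ (2 + 2 * j) * n + offset (suc j))
    ≡⟨ cong p13 (index (3 ^ (1 + 2 * j)) n (offset j)) ⟩
  p13 (3 ^ (1 + 2 * j) * (2 + n * 3) + offset j)
    ≡⟨ oddProgression j (2 + n * 3) ⟩
  oddSeries (1 + 2 * j) (2 + n * 3)
    ≡⟨ odd⇒even (2 * j) (odd?-1+2* j) n ⟩
  evenSeries (2 + 2 * j) n ∎
  where
  open ≡-Reasoning
  index : ∀ y n c → 3 * y * n + (2 * y + c) ≡ y * (2 + n * 3) + c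
  index = solve-∀

theorem3p1 : (j : ℕ) → 1 ≤ j →
    ((n : ℕ) → p13 (3 ^ (2 * j ∸ 1) * n + (3 ^ (2 * j ∸ 1) + 1) / 4)
    ≡ rhsOdd (2 * j ∸ 1) n)
    × ((n : ℕ) → p13 (3 ^ (2 * j) * n + (3 ^ (2 * j + 1) + 1) / 4)
    ≡ rhsEven (2 * j) n)
theorem3p1 (suc j) _ = oddCase , evenCase
  where
  2*suc : 2 * suc j ≡ 2 + 2 * j
  2*suc = ℕₚ.*-suc 2 j
  oddCase : ∀ n → p13 (3 ^ (2 * suc j ∸ 1) * n + (3 ^ (2 * suc j ∸ 1) + 1) / 4)
    ≡ rhsOdd (2 * suc j ∸ 1) n
  oddCase n = subst (λ i → p13 (3 ^ (i ∸ 1) * n + (3 ^ (i ∸ 1) + 1) / 4) ≡ rhsOdd (i ∸ 1) n)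
    (sym 2*suc)
    (trans (cong (λ c → p13 (3 ^ (1 + 2 * j) * n + c)) (offset-spec j))
      (trans (oddProgression j n) (oddSeries≡rhsOdd (1 + 2 * j) n)))
  evenCase : ∀ n → p13 (3 ^ (2 * suc j) * n + (3 ^ (2 * suc j + 1) + 1) / 4) ≡ rhsEven (2 * suc j) n
  evenCase n = trans
    (cong (λ c → p13 (3 ^ (2 * suc j) * n + c))
      (trans (cong (λ i → (3 ^ i + 1) / 4) (ℕₚ.+-comm (2 * suc j) 1)) (offset-spec (suc j))))
    (subst (λ i → p13 (3 ^ i * n + offset (suc j)) ≡ rhsEven i n) (sym 2*suc)
      (trans (evenProgression j n) (evenSeries≡rhsEven (2 + 2 * j) n)))
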